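{- For positive integers $n,k,r$, the dimension of $\mathcal{A}_{r,k}(n)$ is equal to the coefficient of $z^nq^rt^r$ in $$\prod_{i\ge0}\prod_{j\ge0}\frac{1}{\left(1-zq^it^j\right)^{\binom{k+i-1}{i}\binom{k+j-1}{j}}}.$$
   Context: $\mathcal{P}^r(V_{n,k})$ is the space of homogeneous polynomials of degree $r$ over $\mathbb{C}$ in the commuting variables $x_{ij}$, $1\le i\le n$, $1\le j\le k$. The symmetric group $S_n$ acts by $\sigma\cdot x_{i_1j_1}\cdots x_{i_rj_r}=x_{\sigma(i_1)j_1}\cdots x_{\sigma(i_r)j_r}$. $\mathcal{A}_{r,k}(n)=\mathrm{End}_{\mathbb{C}S_n}(\mathcal{P}^r(V_{n,k}))$ is the $\mathbb{C}$-algebra of linear endomorphisms commuting with this action. -}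

module Defs where

open import Algebra.Bundles using (CommutativeRing)
import Algebra.Construct.Pointwise as Pointwise
open import Algebra.Module.Bundles using (LeftModule)
open import Algebra.Module.Morphism.Structures using (module LeftModuleMorphisms)
import Algebra.Properties.CommutativeMonoid.Sum as CommutativeMonoidSum
import Algebra.Properties.CommutativeSemigroup as CommutativeSemigroupProperties
import Algebra.Properties.CommutativeSemiring.Exp as CommutativeSemiringExp
import Algebra.Properties.Ring as RingProperties
import Algebra.Properties.Semiring.Exp as SemiringExp
import Algebra.Solver.Ring.NaturalCoefficients.Default as SemiringSolver
open import Algebra.Structures using (IsAbelianGroup; IsCommutativeRing)
open import Data.Fin.Base using (Fin)
open import Data.Fin.Permutation using (Permutation′; _⟨$⟩ʳ_; _⟨$⟩ˡ_; flip; inverseˡ; inverseʳ)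
import Data.Fin.Properties as Fin
import Data.Integer.Properties as ℤ
open import Data.Nat.Base as ℕ using (ℕ; zero; suc)
open import Data.Nat.Combinatorics using (_C_)
import Data.Nat.Properties as ℕ
open import Data.Product.Base using (Σ; ∃-syntax; _×_; _,_; proj₁; proj₂; map₁)
open import Data.Product.Properties using (≡-dec)
open import Data.Rational.Base as ℚ using (ℚ; 0ℚ; 1ℚ; ½; ∣_∣)
import Data.Rational.Properties as ℚ
open import Data.Rational.Solver using (module +-*-Solver)
open import Data.Vec.Base as Vec using (Vec; []; _∷_; lookup; tabulate; count)
open import Data.Vec.Functional using (Vector)
open import Data.Vec.Properties using (lookup∘tabulate; tabulate-cong)
open import Level using (0ℓ)
import Relation.Binary.Reasoning.Setoid as SetoidReasoning
open import Relation.Binary.PropositionalEquality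
  using (_≡_; refl; sym; trans; cong; cong₂; subst; subst₂)
open import Relation.Nullary using (Dec; yes; no; contradiction)

-- The reals are Cauchy sequences of rationals modulo null sequences:
-- x ∼ x is the Cauchy condition, and on Cauchy sequences x ∼ y says
-- that x − y tends to 0.
infix 4 _∼_

record _∼_ (x y : ℕ → ℚ) : Set where
  constructor mk∼
  field
    within : ∀ ε → 0ℚ ℚ.< ε →
      ∃[ N ] (∀ m n → N ℕ.≤ m → N ℕ.≤ n → ∣ x m ℚ.- y n ∣ ℚ.< ε)

open _∼_ public

record ℝ : Set where
  constructor mkℝ
  field
    seq    : ℕ → ℚ
    cauchy : seq ∼ seq

open ℝ public

infix 4 _≃_

record _≃_ (x y : ℝ) : Set where
  constructor mk≃
  field
    close : seq x ∼ seq y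

open _≃_ public

private
  module Sequences where
    open +-*-Solver using (solve; _:+_; _:*_; _:-_; :-_; _:=_)
    open ℚ.≤-Reasoning

    half-pos : ∀ {ε} → 0ℚ ℚ.< ε → 0ℚ ℚ.< ½ ℚ.* ε
    half-pos {ε} 0<ε = subst (ℚ._< ½ ℚ.* ε) (ℚ.*-zeroʳ ½) (ℚ.*-monoʳ-<-pos ½ 0<ε)

    half+half : ∀ ε → ½ ℚ.* ε ℚ.+ ½ ℚ.* ε ≡ ε
    half+half ε = trans (sym (ℚ.*-distribʳ-+ ε ½ ½)) (ℚ.*-identityˡ ε)

    ∣-∣-comm : ∀ p q → ∣ p ℚ.- q ∣ ≡ ∣ q ℚ.- p ∣
    ∣-∣-comm p q = trans (sym (ℚ.∣-p∣≡∣p∣ (p ℚ.- q)))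
      (cong ∣_∣ (solve 2 (λ a b → :- (a :- b) := b :- a) refl p q))

    combine : ∀ {ε} u v w → w ≡ u ℚ.+ v →
              ∣ u ∣ ℚ.< ½ ℚ.* ε → ∣ v ∣ ℚ.< ½ ℚ.* ε → ∣ w ∣ ℚ.< ε
    combine {ε} u v w w≡u+v u< v< = begin-strict
      ∣ w ∣                    ≡⟨ cong ∣_∣ w≡u+v ⟩
      ∣ u ℚ.+ v ∣              ≤⟨ ℚ.∣p+q∣≤∣p∣+∣q∣ u v ⟩
      ∣ u ∣ ℚ.+ ∣ v ∣          <⟨ ℚ.+-mono-< u< v< ⟩
      ½ ℚ.* ε ℚ.+ ½ ℚ.* ε      ≡⟨ half+half ε ⟩
      ε                        ∎

    ∼-sym : ∀ {x y} → x ∼ y → y ∼ x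
    ∼-sym {x} {y} x∼y .within ε 0<ε with within x∼y ε 0<ε
    ... | N , close = N , λ m n N≤m N≤n →
      subst (ℚ._< ε) (∣-∣-comm (x n) (y m)) (close n m N≤n N≤m)

    ∼-trans : ∀ {x y z} → x ∼ y → y ∼ z → x ∼ z
    ∼-trans {x} {y} {z} x∼y y∼z .within ε 0<ε
      with within x∼y (½ ℚ.* ε) (half-pos 0<ε) | within y∼z (½ ℚ.* ε) (half-pos 0<ε)
    ... | M , xy | N , yz = M ℕ.⊔ N , λ m n ≤m ≤n →
      let j = M ℕ.⊔ N in
      combine (x m ℚ.- y j) (y j ℚ.- z n) (x m ℚ.- z n)
        (solve 3 (λ a b c → a :- c := (a :- b) :+ (b :- c)) refl (x m) (y j) (z n))
        (xy m j (ℕ.m⊔n≤o⇒m≤o M N ≤m) (ℕ.m≤m⊔n M N))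
        (yz j n (ℕ.m≤n⊔m M N) (ℕ.m⊔n≤o⇒n≤o M N ≤n))

    ∼-cong₂ : ∀ {x x′ y y′} → (∀ n → x n ≡ x′ n) → (∀ n → y n ≡ y′ n) → x ∼ y → x′ ∼ y′
    ∼-cong₂ x≗x′ y≗y′ x∼y .within ε 0<ε with within x∼y ε 0<ε
    ... | N , close = N , λ m n N≤m N≤n →
      subst₂ (λ a b → ∣ a ℚ.- b ∣ ℚ.< ε) (x≗x′ m) (y≗y′ n) (close m n N≤m N≤n)

    const∼ : ∀ p → (λ _ → p) ∼ (λ _ → p)
    const∼ p .within ε 0<ε = 0 , λ _ _ _ _ →
      subst (λ a → ∣ a ∣ ℚ.< ε) (sym (ℚ.+-inverseʳ p)) 0<ε

    neg∼ : ∀ {x y} → x ∼ y → (λ n → ℚ.- x n) ∼ (λ n → ℚ.- y n)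
    neg∼ {x} {y} x∼y .within ε 0<ε with within x∼y ε 0<ε
    ... | N , close = N , λ m n N≤m N≤n →
      subst (ℚ._< ε)
        (trans (∣-∣-comm (x m) (y n))
          (cong ∣_∣ (solve 2 (λ a b → b :- a := (:- a) :- (:- b)) refl (x m) (y n))))
        (close m n N≤m N≤n)

    +∼ : ∀ {x x′ y y′} → x ∼ x′ → y ∼ y′ →
         (λ n → x n ℚ.+ y n) ∼ (λ n → x′ n ℚ.+ y′ n)
    +∼ {x} {x′} {y} {y′} x∼x′ y∼y′ .within ε 0<ε
      with within x∼x′ (½ ℚ.* ε) (half-pos 0<ε) | within y∼y′ (½ ℚ.* ε) (half-pos 0<ε)
    ... | M , xx′ | N , yy′ = M ℕ.⊔ N , λ m n ≤m ≤n →
      combine (x m ℚ.- x′ n) (y m ℚ.- y′ n) ((x m ℚ.+ y m) ℚ.- (x′ n ℚ.+ y′ n))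
        (solve 4 (λ a b c d → (a :+ b) :- (c :+ d) := (a :- c) :+ (b :- d)) refl
          (x m) (y m) (x′ n) (y′ n))
        (xx′ m n (ℕ.m⊔n≤o⇒m≤o M N ≤m) (ℕ.m⊔n≤o⇒m≤o M N ≤n))
        (yy′ m n (ℕ.m⊔n≤o⇒n≤o M N ≤m) (ℕ.m⊔n≤o⇒n≤o M N ≤n))

    0<1 : 0ℚ ℚ.< 1ℚ
    0<1 = ℚ.positive⁻¹ 1ℚ

    EventuallyBounded : (ℕ → ℚ) → Set
    EventuallyBounded x = ∃[ B ] ℚ.Positive B × ∃[ N ] (∀ n → N ℕ.≤ n → ∣ x n ∣ ℚ.≤ B)

    bounded : ∀ {x y} → x ∼ y → EventuallyBounded x
    bounded {x} {y} x∼y with within x∼y 1ℚ 0<1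
    ... | N , close = 1ℚ ℚ.+ ∣ y N ∣ ,
      ℚ.pos+nonNeg⇒pos 1ℚ ∣ y N ∣ {{ℚ.∣-∣-nonNeg (y N)}} , N , λ n N≤n → begin
        ∣ x n ∣                       ≡⟨ cong ∣_∣ (solve 2 (λ a b → a := (a :- b) :+ b) refl (x n) (y N)) ⟩
        ∣ (x n ℚ.- y N) ℚ.+ y N ∣     ≤⟨ ℚ.∣p+q∣≤∣p∣+∣q∣ (x n ℚ.- y N) (y N) ⟩
        ∣ x n ℚ.- y N ∣ ℚ.+ ∣ y N ∣   ≤⟨ ℚ.+-monoˡ-≤ ∣ y N ∣ (ℚ.<⇒≤ (close n N N≤n ℕ.≤-refl)) ⟩
        1ℚ ℚ.+ ∣ y N ∣                ∎

    module _ (B : ℚ) {{B>0 : ℚ.Positive B}} where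

      private instance
        B≢0 : ℚ.NonZero B
        B≢0 = ℚ.pos⇒nonZero B

      shrink : ℚ → ℚ
      shrink ε = ℚ.1/ B ℚ.* ε

      shrink-pos : ∀ {ε} → 0ℚ ℚ.< ε → 0ℚ ℚ.< shrink ε
      shrink-pos {ε} 0<ε = subst (ℚ._< shrink ε) (ℚ.*-zeroʳ (ℚ.1/ B))
        (ℚ.*-monoʳ-<-pos (ℚ.1/ B) {{ℚ.1/pos⇒pos B}} 0<ε)

      *-shrink : ∀ ε → B ℚ.* shrink ε ≡ ε
      *-shrink ε = trans (sym (ℚ.*-assoc B (ℚ.1/ B) ε))
        (trans (cong (ℚ._* ε) (ℚ.*-inverseʳ B)) (ℚ.*-identityˡ ε))

      small-product : ∀ {ε} u v → ∣ u ∣ ℚ.≤ B → ∣ v ∣ ℚ.< shrink ε → ∣ u ℚ.* v ∣ ℚ.< ε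
      small-product {ε} u v u≤B v< = begin-strict
        ∣ u ℚ.* v ∣         ≡⟨ ℚ.∣p*q∣≡∣p∣*∣q∣ u v ⟩
        ∣ u ∣ ℚ.* ∣ v ∣     ≤⟨ ℚ.*-monoʳ-≤-nonNeg ∣ v ∣ {{ℚ.∣-∣-nonNeg v}} u≤B ⟩
        B ℚ.* ∣ v ∣         <⟨ ℚ.*-monoʳ-<-pos B v< ⟩
        B ℚ.* shrink ε      ≡⟨ *-shrink ε ⟩
        ε                   ∎

    difference-of-products : ∀ a b c d →
      a ℚ.* b ℚ.- c ℚ.* d ≡ a ℚ.* (b ℚ.- d) ℚ.+ d ℚ.* (a ℚ.- c)
    difference-of-products a b c d = trans
      (solve 3 (λ u v w → u :- w := (u :- v) :+ (v :- w)) refl (a ℚ.* b) (a ℚ.* d) (c ℚ.* d))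
      (cong₂ ℚ._+_ (factor-out a b d)
        (trans (cong₂ ℚ._-_ (ℚ.*-comm a d) (ℚ.*-comm c d)) (factor-out d a c)))
      where
      factor-out : ∀ p q r → p ℚ.* q ℚ.- p ℚ.* r ≡ p ℚ.* (q ℚ.- r)
      factor-out p q r = trans (cong (p ℚ.* q ℚ.+_) (ℚ.neg-distribʳ-* p r))
        (sym (ℚ.*-distribˡ-+ p q (ℚ.- r)))

    *∼ : ∀ {x x′ y y′} → x ∼ x′ → y ∼ y′ →
         (λ n → x n ℚ.* y n) ∼ (λ n → x′ n ℚ.* y′ n)
    *∼ {x} {x′} {y} {y′} x∼x′ y∼y′ .within ε 0<ε = (K ℕ.⊔ L) ℕ.⊔ (M ℕ.⊔ N) , estimate
      where
      xb = bounded x∼x′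
      yb = bounded (∼-sym y∼y′)
      B = proj₁ xb
      D = proj₁ yb
      B>0 : ℚ.Positive B
      B>0 = proj₁ (proj₂ xb)
      D>0 : ℚ.Positive D
      D>0 = proj₁ (proj₂ yb)
      K = proj₁ (proj₂ (proj₂ xb))
      L = proj₁ (proj₂ (proj₂ yb))
      xx = within x∼x′ (shrink D {{D>0}} (½ ℚ.* ε)) (shrink-pos D {{D>0}} (half-pos 0<ε))
      yy = within y∼y′ (shrink B {{B>0}} (½ ℚ.* ε)) (shrink-pos B {{B>0}} (half-pos 0<ε))
      M = proj₁ xx
      N = proj₁ yy

      estimate : ∀ m n → (K ℕ.⊔ L) ℕ.⊔ (M ℕ.⊔ N) ℕ.≤ m → (K ℕ.⊔ L) ℕ.⊔ (M ℕ.⊔ N) ℕ.≤ n →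
                 ∣ x m ℚ.* y m ℚ.- x′ n ℚ.* y′ n ∣ ℚ.< ε
      estimate m n ≤m ≤n =
        combine {ε} (x m ℚ.* (y m ℚ.- y′ n)) (y′ n ℚ.* (x m ℚ.- x′ n))
          (x m ℚ.* y m ℚ.- x′ n ℚ.* y′ n)
          (difference-of-products (x m) (y m) (x′ n) (y′ n))
          (small-product B {{B>0}} {½ ℚ.* ε} (x m) (y m ℚ.- y′ n)
            (proj₂ (proj₂ (proj₂ xb)) m (ℕ.m⊔n≤o⇒m≤o K L KLm))
            (proj₂ yy m n (ℕ.m⊔n≤o⇒n≤o M N MNm) (ℕ.m⊔n≤o⇒n≤o M N MNn)))
          (small-product D {{D>0}} {½ ℚ.* ε} (y′ n) (x m ℚ.- x′ n)
            (proj₂ (proj₂ (proj₂ yb)) n (ℕ.m⊔n≤o⇒n≤o K L KLn))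
            (proj₂ xx m n (ℕ.m⊔n≤o⇒m≤o M N MNm) (ℕ.m⊔n≤o⇒m≤o M N MNn)))
        where
        KLm = ℕ.m⊔n≤o⇒m≤o (K ℕ.⊔ L) (M ℕ.⊔ N) ≤m
        KLn = ℕ.m⊔n≤o⇒m≤o (K ℕ.⊔ L) (M ℕ.⊔ N) ≤n
        MNm = ℕ.m⊔n≤o⇒n≤o (K ℕ.⊔ L) (M ℕ.⊔ N) ≤m
        MNn = ℕ.m⊔n≤o⇒n≤o (K ℕ.⊔ L) (M ℕ.⊔ N) ≤n

    pointwise : ∀ x y → (∀ n → seq x n ≡ seq y n) → x ≃ y
    pointwise x y x≗y = mk≃ (∼-cong₂ (λ _ → refl) x≗y (cauchy x))

open Sequences

ℝ-ring : CommutativeRing 0ℓ 0ℓ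
ℝ-ring = record
  { Carrier = ℝ
  ; _≈_     = _≃_
  ; _+_     = _+_
  ; _*_     = _*_
  ; -_      = -_
  ; 0#      = fromℚ 0ℚ
  ; 1#      = fromℚ 1ℚ
  ; isCommutativeRing = isCommutativeRing
  }
  where
  fromℚ : ℚ → ℝ
  fromℚ p = mkℝ (λ _ → p) (const∼ p)

  _+_ _*_ : ℝ → ℝ → ℝ
  x + y = mkℝ (λ n → seq x n ℚ.+ seq y n) (+∼ (cauchy x) (cauchy y))
  x * y = mkℝ (λ n → seq x n ℚ.* seq y n) (*∼ (cauchy x) (cauchy y))

  -_ : ℝ → ℝ
  - x = mkℝ (λ n → ℚ.- seq x n) (neg∼ (cauchy x))

  abstract
    isCommutativeRing : IsCommutativeRing _≃_ _+_ _*_ -_ (fromℚ 0ℚ) (fromℚ 1ℚ)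
    isCommutativeRing = record
      { isRing = record
        { +-isAbelianGroup = record
          { isGroup = record
            { isMonoid = record
              { isSemigroup = record
                { isMagma = record
                  { isEquivalence = record
                    { refl  = λ {x} → mk≃ (cauchy x)
                    ; sym   = λ p → mk≃ (∼-sym (close p))
                    ; trans = λ p q → mk≃ (∼-trans (close p) (close q))
                    }
                  ; ∙-cong = λ p q → mk≃ (+∼ (close p) (close q))
                  }
                ; assoc = λ x y z → pointwise _ _ λ n → ℚ.+-assoc (seq x n) (seq y n) (seq z n)
                }
              ; identity = (λ x → pointwise _ _ λ n → ℚ.+-identityˡ (seq x n))
                         , (λ x → pointwise _ _ λ n → ℚ.+-identityʳ (seq x n))
              }
            ; inverse = (λ x → pointwise _ _ λ n → ℚ.+-inverseˡ (seq x n))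
                      , (λ x → pointwise _ _ λ n → ℚ.+-inverseʳ (seq x n))
            ; ⁻¹-cong = λ p → mk≃ (neg∼ (close p))
            }
          ; comm = λ x y → pointwise _ _ λ n → ℚ.+-comm (seq x n) (seq y n)
          }
        ; *-cong = λ p q → mk≃ (*∼ (close p) (close q))
        ; *-assoc = λ x y z → pointwise _ _ λ n → ℚ.*-assoc (seq x n) (seq y n) (seq z n)
        ; *-identity = (λ x → pointwise _ _ λ n → ℚ.*-identityˡ (seq x n))
                     , (λ x → pointwise _ _ λ n → ℚ.*-identityʳ (seq x n))
        ; distrib = (λ x y z → pointwise _ _ λ n → ℚ.*-distribˡ-+ (seq x n) (seq y n) (seq z n))
                  , (λ x y z → pointwise _ _ λ n → ℚ.*-distribʳ-+ (seq x n) (seq y n) (seq z n))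
        }
      ; *-comm = λ x y → pointwise _ _ λ n → ℚ.*-comm (seq x n) (seq y n)
      }

module AdjoinI (R : CommutativeRing 0ℓ 0ℓ) where

  private module R = CommutativeRing R
  open RingProperties R.ring using (-0#≈0#; -‿distribˡ-*; -‿distribʳ-*; -‿+-comm)
  open SemiringSolver R.commutativeSemiring using (solve; _:+_; _:*_; _:=_)

  record R[i] : Set where
    constructor _+i_
    field
      re im : R.Carrier

  open R[i] public

  infix 4 _≈ᶜ_

  record _≈ᶜ_ (w z : R[i]) : Set where
    constructor _,ᶜ_
    field
      re≈ : re w R.≈ re z
      im≈ : im w R.≈ im z

  open _≈ᶜ_ public

  _+_ _*_ : R[i] → R[i] → R[i]
  (a +i b) + (c +i d) = (a R.+ c) +i (b R.+ d)
  (a +i b) * (c +i d) = (a R.* c R.- b R.* d) +i (a R.* d R.+ b R.* c)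

  -_ : R[i] → R[i]
  - (a +i b) = (R.- a) +i (R.- b)

  0# 1# : R[i]
  0# = R.0# +i R.0#
  1# = R.1# +i R.0#

  private abstract
    ∸→+ : ∀ x y z → x R.- y R.* z R.≈ x R.+ (R.- y) R.* z
    ∸→+ x y z = R.+-congˡ (-‿distribˡ-* y z)

    *-assoc : ∀ x y z → ((x * y) * z) ≈ᶜ (x * (y * z))
    *-assoc (a +i b) (c +i d) (e +i f) =
      (begin
        (a R.* c R.- b R.* d) R.* e R.- (a R.* d R.+ b R.* c) R.* f
          ≈⟨ R.+-cong (R.*-congʳ (∸→+ _ b d)) (-‿distribˡ-* _ f) ⟩
        (a R.* c R.+ b⁻ R.* d) R.* e R.+ (R.- (a R.* d R.+ b R.* c)) R.* f
          ≈⟨ R.+-congˡ (R.*-congʳ (R.trans (R.sym (-‿+-comm _ _))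
               (R.+-cong (-‿distribʳ-* a d) (-‿distribˡ-* b c)))) ⟩
        (a R.* c R.+ b⁻ R.* d) R.* e R.+ (a R.* d⁻ R.+ b⁻ R.* c) R.* f
          ≈⟨ solve 8 (λ a b c d e f b⁻ d⁻ →
               (a :* c :+ b⁻ :* d) :* e :+ (a :* d⁻ :+ b⁻ :* c) :* f
               := a :* (c :* e :+ d⁻ :* f) :+ b⁻ :* (c :* f :+ d :* e))
               R.refl a b c d e f b⁻ d⁻ ⟩
        a R.* (c R.* e R.+ d⁻ R.* f) R.+ b⁻ R.* (c R.* f R.+ d R.* e)
          ≈⟨ R.+-cong (R.*-congˡ (∸→+ _ d f)) (-‿distribˡ-* b _) ⟨
        a R.* (c R.* e R.- d R.* f) R.- b R.* (c R.* f R.+ d R.* e) ∎)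
      ,ᶜ
      (begin
        (a R.* c R.- b R.* d) R.* f R.+ (a R.* d R.+ b R.* c) R.* e
          ≈⟨ R.+-congʳ (R.*-congʳ (R.+-congˡ (-‿distribʳ-* b d))) ⟩
        (a R.* c R.+ b R.* d⁻) R.* f R.+ (a R.* d R.+ b R.* c) R.* e
          ≈⟨ solve 7 (λ a b c d e f d⁻ →
               (a :* c :+ b :* d⁻) :* f :+ (a :* d :+ b :* c) :* e
               := a :* (c :* f :+ d :* e) :+ b :* (c :* e :+ d⁻ :* f))
               R.refl a b c d e f d⁻ ⟩
        a R.* (c R.* f R.+ d R.* e) R.+ b R.* (c R.* e R.+ d⁻ R.* f)
          ≈⟨ R.+-congˡ (R.*-congˡ (∸→+ _ d f)) ⟨
        a R.* (c R.* f R.+ d R.* e) R.+ b R.* (c R.* e R.- d R.* f) ∎)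
      where
      open SetoidReasoning R.setoid
      b⁻ : R.Carrier
      b⁻ = R.- b
      d⁻ : R.Carrier
      d⁻ = R.- d

    *-comm : ∀ x y → (x * y) ≈ᶜ (y * x)
    *-comm (a +i b) (c +i d) =
      R.+-cong (R.*-comm a c) (R.-‿cong (R.*-comm b d))
      ,ᶜ
      R.trans (R.+-comm (a R.* d) (b R.* c)) (R.+-cong (R.*-comm b c) (R.*-comm a d))

    *-identityˡ : ∀ x → (1# * x) ≈ᶜ x
    *-identityˡ (a +i b) =
      R.trans (R.+-cong (R.*-identityˡ a)
                (R.trans (R.-‿cong (R.zeroˡ b)) -0#≈0#))
        (R.+-identityʳ a)
      ,ᶜ
      R.trans (R.+-cong (R.*-identityˡ b) (R.zeroˡ a)) (R.+-identityʳ b)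

    distribˡ : ∀ x y z → (x * (y + z)) ≈ᶜ ((x * y) + (x * z))
    distribˡ (a +i b) (c +i d) (e +i f) =
      (begin
        a R.* (c R.+ e) R.- b R.* (d R.+ f)
          ≈⟨ ∸→+ _ b _ ⟩
        a R.* (c R.+ e) R.+ b⁻ R.* (d R.+ f)
          ≈⟨ solve 6 (λ a b⁻ c d e f →
               a :* (c :+ e) :+ b⁻ :* (d :+ f)
               := (a :* c :+ b⁻ :* d) :+ (a :* e :+ b⁻ :* f))
               R.refl a b⁻ c d e f ⟩
        (a R.* c R.+ b⁻ R.* d) R.+ (a R.* e R.+ b⁻ R.* f)
          ≈⟨ R.+-cong (∸→+ _ b d) (∸→+ _ b f) ⟨
        (a R.* c R.- b R.* d) R.+ (a R.* e R.- b R.* f) ∎)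
      ,ᶜ
      solve 6 (λ a b c d e f →
        a :* (d :+ f) :+ b :* (c :+ e)
        := (a :* d :+ b :* c) :+ (a :* f :+ b :* e)) R.refl a b c d e f
      where
      open SetoidReasoning R.setoid
      b⁻ : R.Carrier
      b⁻ = R.- b

    +-isAbelianGroup : IsAbelianGroup _≈ᶜ_ _+_ 0# -_
    +-isAbelianGroup = record
      { isGroup = record
        { isMonoid = record
          { isSemigroup = record
            { isMagma = record
              { isEquivalence = record
                { refl  = R.refl ,ᶜ R.refl
                ; sym   = λ p → R.sym (re≈ p) ,ᶜ R.sym (im≈ p)
                ; trans = λ p q → R.trans (re≈ p) (re≈ q) ,ᶜ R.trans (im≈ p) (im≈ q)
                }
              ; ∙-cong = λ p q → R.+-cong (re≈ p) (re≈ q) ,ᶜ R.+-cong (im≈ p) (im≈ q)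
              }
            ; assoc = λ x y z → R.+-assoc (re x) (re y) (re z) ,ᶜ R.+-assoc (im x) (im y) (im z)
            }
          ; identity = (λ x → R.+-identityˡ (re x) ,ᶜ R.+-identityˡ (im x))
                     , (λ x → R.+-identityʳ (re x) ,ᶜ R.+-identityʳ (im x))
          }
        ; inverse = (λ x → R.-‿inverseˡ (re x) ,ᶜ R.-‿inverseˡ (im x))
                  , (λ x → R.-‿inverseʳ (re x) ,ᶜ R.-‿inverseʳ (im x))
        ; ⁻¹-cong = λ p → R.-‿cong (re≈ p) ,ᶜ R.-‿cong (im≈ p)
        }
      ; comm = λ x y → R.+-comm (re x) (re y) ,ᶜ R.+-comm (im x) (im y)
      }

    isCommutativeRing : IsCommutativeRing _≈ᶜ_ _+_ _*_ -_ 0# 1#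
    isCommutativeRing = record
      { isRing = record
        { +-isAbelianGroup = +-isAbelianGroup
        ; *-cong = λ p q →
            R.+-cong (R.*-cong (re≈ p) (re≈ q)) (R.-‿cong (R.*-cong (im≈ p) (im≈ q)))
            ,ᶜ
            R.+-cong (R.*-cong (re≈ p) (im≈ q)) (R.*-cong (im≈ p) (re≈ q))
        ; *-assoc = *-assoc
        ; *-identity = *-identityˡ , λ x → +-trans (*-comm x 1#) (*-identityˡ x)
        ; distrib = distribˡ , λ x y z →
            +-trans (*-comm (y + z) x)
              (+-trans (distribˡ x y z) (IsAbelianGroup.∙-cong +-isAbelianGroup (*-comm x y) (*-comm x z)))
        }
      ; *-comm = *-comm
      }
      where
      +-trans : ∀ {x y z} → x ≈ᶜ y → y ≈ᶜ z → x ≈ᶜ z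
      +-trans = IsAbelianGroup.trans +-isAbelianGroup

  ring : CommutativeRing 0ℓ 0ℓ
  ring = record { isCommutativeRing = isCommutativeRing }

ℂ-ring : CommutativeRing 0ℓ 0ℓ
ℂ-ring = AdjoinI.ring ℝ-ring

module PowerSeries (R : CommutativeRing 0ℓ 0ℓ) where

  private module R = CommutativeRing R

  Series : Set
  Series = ℕ → R.Carrier

  infix 4 _≋_

  record _≋_ (f g : Series) : Set where
    constructor mk≋
    field
      at : ∀ n → f n R.≈ g n

  open _≋_ public

  -- The Cauchy product Σ_{a+b=n} fₐ g_b, by splitting off the term a = 0.
  _⊛_ : Series → Series → Series
  (f ⊛ g) zero    = f 0 R.* g 0
  (f ⊛ g) (suc n) = f 0 R.* g (suc n) R.+ ((λ m → f (suc m)) ⊛ g) n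

  constant : R.Carrier → Series
  constant c zero    = c
  constant c (suc _) = R.0#

  X : Series
  X zero    = R.0#
  X (suc n) = constant R.1# n

  private
    open SetoidReasoning R.setoid

    tail : Series → Series
    tail f n = f (suc n)

    _⊞_ : Series → Series → Series
    (f ⊞ g) n = f n R.+ g n

    abstract
      ⊛-cong : ∀ {f f′ g g′} → f ≋ f′ → g ≋ g′ → ∀ n → (f ⊛ g) n R.≈ (f′ ⊛ g′) n
      ⊛-cong p q zero    = R.*-cong (at p 0) (at q 0)
      ⊛-cong p q (suc n) = R.+-cong (R.*-cong (at p 0) (at q (suc n)))
        (⊛-cong (mk≋ λ m → at p (suc m)) q n)

      ⊛-sucʳ : ∀ f g n → (f ⊛ g) (suc n) R.≈ f (suc n) R.* g 0 R.+ (f ⊛ tail g) n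
      ⊛-sucʳ f g zero    = R.+-comm _ _
      ⊛-sucʳ f g (suc n) = begin
        f 0 R.* g (suc (suc n)) R.+ (tail f ⊛ g) (suc n)
          ≈⟨ R.+-congˡ (⊛-sucʳ (tail f) g n) ⟩
        f 0 R.* g (suc (suc n)) R.+ (f (suc (suc n)) R.* g 0 R.+ (tail f ⊛ tail g) n)
          ≈⟨ R.+-assoc _ _ _ ⟨
        (f 0 R.* g (suc (suc n)) R.+ f (suc (suc n)) R.* g 0) R.+ (tail f ⊛ tail g) n
          ≈⟨ R.+-congʳ (R.+-comm _ _) ⟩
        (f (suc (suc n)) R.* g 0 R.+ f 0 R.* g (suc (suc n))) R.+ (tail f ⊛ tail g) n
          ≈⟨ R.+-assoc _ _ _ ⟩
        f (suc (suc n)) R.* g 0 R.+ (f 0 R.* g (suc (suc n)) R.+ (tail f ⊛ tail g) n) ∎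

      ⊛-comm : ∀ f g n → (f ⊛ g) n R.≈ (g ⊛ f) n
      ⊛-comm f g zero    = R.*-comm _ _
      ⊛-comm f g (suc n) = begin
        f 0 R.* g (suc n) R.+ (tail f ⊛ g) n   ≈⟨ R.+-cong (R.*-comm _ _) (⊛-comm (tail f) g n) ⟩
        g (suc n) R.* f 0 R.+ (g ⊛ tail f) n   ≈⟨ ⊛-sucʳ g f n ⟨
        (g ⊛ f) (suc n)                        ∎

      ⊛-distribʳ : ∀ h f g n → ((f ⊞ g) ⊛ h) n R.≈ (f ⊛ h) n R.+ (g ⊛ h) n
      ⊛-distribʳ h f g zero    = R.distribʳ _ _ _
      ⊛-distribʳ h f g (suc n) = begin
        (f 0 R.+ g 0) R.* h (suc n) R.+ ((tail f ⊞ tail g) ⊛ h) n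
          ≈⟨ R.+-cong (R.distribʳ _ _ _) (⊛-distribʳ h (tail f) (tail g) n) ⟩
        (f 0 R.* h (suc n) R.+ g 0 R.* h (suc n)) R.+ ((tail f ⊛ h) n R.+ (tail g ⊛ h) n)
          ≈⟨ interchange _ _ _ _ ⟩
        (f ⊛ h) (suc n) R.+ (g ⊛ h) (suc n) ∎
        where
        open CommutativeSemigroupProperties R.+-commutativeSemigroup using (interchange)

      ⊛-distribˡ : ∀ h f g n → (h ⊛ (f ⊞ g)) n R.≈ (h ⊛ f) n R.+ (h ⊛ g) n
      ⊛-distribˡ h f g n = R.trans (⊛-comm h (f ⊞ g) n)
        (R.trans (⊛-distribʳ h f g n) (R.+-cong (⊛-comm f h n) (⊛-comm g h n)))

      ⊛-scale : ∀ c f g n → ((λ m → c R.* f m) ⊛ g) n R.≈ c R.* (f ⊛ g) n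
      ⊛-scale c f g zero    = R.*-assoc _ _ _
      ⊛-scale c f g (suc n) = R.trans
        (R.+-cong (R.*-assoc _ _ _) (⊛-scale c (tail f) g n)) (R.sym (R.distribˡ _ _ _))

      ⊛-assoc : ∀ f g h n → ((f ⊛ g) ⊛ h) n R.≈ (f ⊛ (g ⊛ h)) n
      ⊛-assoc f g h zero    = R.*-assoc _ _ _
      ⊛-assoc f g h (suc n) = begin
        (f 0 R.* g 0) R.* h (suc n) R.+ (((λ m → f 0 R.* tail g m) ⊞ (tail f ⊛ g)) ⊛ h) n
          ≈⟨ R.+-cong (R.*-assoc _ _ _) (⊛-distribʳ h _ _ n) ⟩
        f 0 R.* (g 0 R.* h (suc n)) R.+ (((λ m → f 0 R.* tail g m) ⊛ h) n R.+ ((tail f ⊛ g) ⊛ h) n)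
          ≈⟨ R.+-congˡ (R.+-cong (⊛-scale (f 0) (tail g) h n) (⊛-assoc (tail f) g h n)) ⟩
        f 0 R.* (g 0 R.* h (suc n)) R.+ (f 0 R.* (tail g ⊛ h) n R.+ (tail f ⊛ (g ⊛ h)) n)
          ≈⟨ R.+-assoc _ _ _ ⟨
        (f 0 R.* (g 0 R.* h (suc n)) R.+ f 0 R.* (tail g ⊛ h) n) R.+ (tail f ⊛ (g ⊛ h)) n
          ≈⟨ R.+-congʳ (R.distribˡ _ _ _) ⟨
        (f ⊛ (g ⊛ h)) (suc n) ∎

      ⊛-zeroˡ : ∀ f n → ((λ _ → R.0#) ⊛ f) n R.≈ R.0#
      ⊛-zeroˡ f zero    = R.zeroˡ _
      ⊛-zeroˡ f (suc n) = R.trans (R.+-cong (R.zeroˡ _) (⊛-zeroˡ f n)) (R.+-identityˡ _)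

      constant-⊛ : ∀ c f n → (constant c ⊛ f) n R.≈ c R.* f n
      constant-⊛ c f zero    = R.refl
      constant-⊛ c f (suc n) = R.trans (R.+-congˡ (⊛-zeroˡ f n)) (R.+-identityʳ _)

      ⊛-identityˡ : ∀ f n → (constant R.1# ⊛ f) n R.≈ f n
      ⊛-identityˡ f n = R.trans (constant-⊛ R.1# f n) (R.*-identityˡ _)

      isCommutativeRing : IsCommutativeRing _≋_ _⊞_ _⊛_ (λ f n → R.- f n)
        (λ _ → R.0#) (constant R.1#)
      isCommutativeRing = record
        { isRing = record
          { +-isAbelianGroup = record
            { isGroup = record
              { isMonoid = record
                { isSemigroup = record
                  { isMagma = record
                    { isEquivalence = record
                      { refl  = mk≋ λ _ → R.refl
                      ; sym   = λ p → mk≋ λ n → R.sym (at p n)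
                      ; trans = λ p q → mk≋ λ n → R.trans (at p n) (at q n)
                      }
                    ; ∙-cong = λ p q → mk≋ λ n → R.+-cong (at p n) (at q n)
                    }
                  ; assoc = λ f g h → mk≋ λ n → R.+-assoc (f n) (g n) (h n)
                  }
                ; identity = (λ f → mk≋ λ n → R.+-identityˡ (f n))
                           , (λ f → mk≋ λ n → R.+-identityʳ (f n))
                }
              ; inverse = (λ f → mk≋ λ n → R.-‿inverseˡ (f n))
                        , (λ f → mk≋ λ n → R.-‿inverseʳ (f n))
              ; ⁻¹-cong = λ p → mk≋ λ n → R.-‿cong (at p n)
              }
            ; comm = λ f g → mk≋ λ n → R.+-comm (f n) (g n)
            }
          ; *-cong = λ p q → mk≋ (⊛-cong p q)
          ; *-assoc = λ f g h → mk≋ (⊛-assoc f g h)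
          ; *-identity = (λ f → mk≋ (⊛-identityˡ f))
                       , (λ f → mk≋ λ n → R.trans (⊛-comm f _ n) (⊛-identityˡ f n))
          ; distrib = (λ h f g → mk≋ (⊛-distribˡ h f g)) , (λ h f g → mk≋ (⊛-distribʳ h f g))
          }
        ; *-comm = λ f g → mk≋ (⊛-comm f g)
        }

  ring : CommutativeRing 0ℓ 0ℓ
  ring = record { isCommutativeRing = isCommutativeRing }

  private module S = CommutativeRing ring
  open SemiringExp R.semiring using (_^_)

  -- 1/(1 − c X) = Σₘ cᵐ Xᵐ
  1/1-_X : R.Carrier → Series
  1/1- c X = λ m → c ^ m

  1/1-X-inverse : ∀ c → (S.1# S.- constant c S.* X) S.* 1/1- c X S.≈ S.1#
  1/1-X-inverse c = S.trans (S.distribʳ G S.1# (S.- (constant c S.* X)))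
    (S.trans (S.+-cong (S.*-identityˡ G) (S.sym (SP.-‿distribˡ-* _ G)))
      (mk≋ λ n → R.trans (R.+-congˡ (R.-‿cong (R.trans
        (⊛-assoc (constant c) X G n) (constant-⊛ c (X ⊛ G) n)))) (telescope n)))
    where
    module SP = RingProperties S.ring
    open RingProperties R.ring using (-0#≈0#)
    G = 1/1- c X
    telescope : ∀ n → G n R.- c R.* (X ⊛ G) n R.≈ constant R.1# n
    telescope zero = R.trans (R.+-congˡ (R.trans (R.-‿cong
      (R.trans (R.*-congˡ (R.zeroˡ _)) (R.zeroʳ c))) -0#≈0#)) (R.+-identityʳ _)
    telescope (suc n) = R.trans (R.+-congˡ (R.-‿cong (R.*-congˡ
      (R.trans (R.+-cong (R.zeroˡ _) (⊛-identityˡ G n)) (R.+-identityˡ _))))) (R.-‿inverseʳ _)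

-- Z.Series is ℤ[[t]][[q]][[z]]; the coefficient of zⁿ qᵃ tᵇ in F is F n a b.

module T = PowerSeries ℤ.+-*-commutativeRing
module Q = PowerSeries T.ring
module Z = PowerSeries Q.ring

module Rings where
  module ℤ⟦t⟧ where
    open CommutativeRing T.ring public
    open SemiringExp semiring public using (_^_)

  module ℤ⟦t,q⟧ where
    open CommutativeRing Q.ring public
    open SemiringExp semiring public using (_^_)

  module ℤ⟦t,q,z⟧ where
    open CommutativeRing Z.ring public
    open SemiringExp semiring public using (_^_)
    open CommutativeSemiringExp commutativeSemiring public using (^-distrib-*)

open Rings
open ℤ⟦t,q,z⟧ using () renaming (_≈_ to _≈ᶻ_; _*_ to _*ᶻ_; _-_ to _-ᶻ_; 1# to 1ᶻ; _^_ to _^ᶻ_)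

∏< : ℕ → (ℕ → Z.Series) → Z.Series
∏< zero    F = 1ᶻ
∏< (suc m) F = ∏< m F *ᶻ F m

-- Convergence of an infinite product of formal power series: each
-- coefficient of the partial products is eventually constant.
Multipliable : (ℕ → Z.Series) → Set
Multipliable F = ∀ n a b → ∃[ N ] (∀ m → N ℕ.≤ m → ∏< m F n a b ≡ ∏< N F n a b)

∏∞ : (F : ℕ → Z.Series) → Multipliable F → Z.Series
∏∞ F converges n a b = ∏< (proj₁ (converges n a b)) F n a b

qᵃtᵇ : ℕ → ℕ → Q.Series
qᵃtᵇ a b = Q.X ℤ⟦t,q⟧.^ a ℤ⟦t,q⟧.* Q.constant (T.X ℤ⟦t⟧.^ b)

exponent : ℕ → ℕ → ℕ → ℕ
exponent k i j = ((k ℕ.+ i ℕ.∸ 1) C i) ℕ.* ((k ℕ.+ j ℕ.∸ 1) C j)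

factor : ℕ → ℕ → ℕ → Z.Series
factor k i j = Z.1/1- (qᵃtᵇ i j) X ^ᶻ exponent k i j

factor-inverse : ∀ k i j →
  (1ᶻ -ᶻ Z.constant (qᵃtᵇ i j) *ᶻ Z.X) ^ᶻ exponent k i j *ᶻ factor k i j ≈ᶻ 1ᶻ
factor-inverse k i j = W.trans (W.sym (W.^-distrib-* _ _ e))
  (W.trans (SemiringExp.^-congˡ W.semiring e (Z.1/1-X-inverse (qᵃtᵇ i j))) (1^ e))
  where
  module W = ℤ⟦t,q,z⟧
  e = exponent k i j
  1^ : ∀ m → 1ᶻ ^ᶻ m ≈ᶻ 1ᶻ
  1^ zero    = W.refl
  1^ (suc m) = W.trans (W.*-identityˡ _) (1^ m)

module Truncation where
  record Congruence (R : CommutativeRing 0ℓ 0ℓ) : Set₁ where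
    open CommutativeRing R hiding (refl; sym; trans)
    field
      _≅_     : Carrier → Carrier → Set
      ≈⇒≅     : ∀ {x y} → x ≈ y → x ≅ y
      ≅-trans : ∀ {x y z} → x ≅ y → y ≅ z → x ≅ z
      +-≅     : ∀ {x x′ y y′} → x ≅ x′ → y ≅ y′ → (x + y) ≅ (x′ + y′)
      *-≅     : ∀ {x x′ y y′} → x ≅ x′ → y ≅ y′ → (x * y) ≅ (x′ * y′)

    ≅-refl : ∀ {x} → x ≅ x
    ≅-refl = ≈⇒≅ (CommutativeRing.refl R)

    open SemiringExp semiring using (_^_)

    ^-≅1 : ∀ {x} m → x ≅ 1# → (x ^ m) ≅ 1#
    ^-≅1 zero    p = ≅-refl
    ^-≅1 (suc m) p = ≅-trans (*-≅ p (^-≅1 m p)) (≈⇒≅ (*-identityˡ 1#))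

  equality : ∀ R → Congruence R
  equality R = record
    { _≅_ = R._≈_ ; ≈⇒≅ = λ p → p ; ≅-trans = R.trans ; +-≅ = R.+-cong ; *-≅ = R.*-cong }
    where module R = CommutativeRing R

  module Coefficientwise {R : CommutativeRing 0ℓ 0ℓ} (E : Congruence R) where
    open Congruence E
    open PowerSeries R
    private module R = CommutativeRing R

    ⊛-≅ : ∀ {f f′ g g′} n → (∀ m → m ℕ.≤ n → f m ≅ f′ m) → (∀ m → m ℕ.≤ n → g m ≅ g′ m) →
          (f ⊛ g) n ≅ (f′ ⊛ g′) n
    ⊛-≅ zero    p q = *-≅ (p 0 ℕ.z≤n) (q 0 ℕ.z≤n)
    ⊛-≅ (suc n) p q = +-≅ (*-≅ (p 0 ℕ.z≤n) (q (suc n) ℕ.≤-refl))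
      (⊛-≅ n (λ m m≤n → p (suc m) (ℕ.s≤s m≤n)) (λ m m≤n → q m (ℕ.m≤n⇒m≤1+n m≤n)))

    everywhere : Congruence ring
    everywhere = record
      { _≅_     = λ f g → ∀ n → f n ≅ g n
      ; ≈⇒≅     = λ p n → ≈⇒≅ (at p n)
      ; ≅-trans = λ p q n → ≅-trans (p n) (q n)
      ; +-≅     = λ p q n → +-≅ (p n) (q n)
      ; *-≅     = λ p q n → ⊛-≅ n (λ m _ → p m) (λ m _ → q m)
      }

    below : ℕ → Congruence ring
    below N = record
      { _≅_     = λ f g → ∀ n → n ℕ.< N → f n ≅ g n
      ; ≈⇒≅     = λ p n _ → ≈⇒≅ (at p n)
      ; ≅-trans = λ p q n n<N → ≅-trans (p n n<N) (q n n<N)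
      ; +-≅     = λ p q n n<N → +-≅ (p n n<N) (q n n<N)
      ; *-≅     = λ p q n n<N → ⊛-≅ n (λ m m≤n → p m (ℕ.≤-<-trans m≤n n<N))
                                      (λ m m≤n → q m (ℕ.≤-<-trans m≤n n<N))
      }

  X^-below : ∀ R a n → n ℕ.< a →
    let open CommutativeRing (PowerSeries.ring R) using (semiring)
        open SemiringExp semiring using (_^_)
    in CommutativeRing._≈_ R ((PowerSeries.X R ^ a) n) (CommutativeRing.0# R)
  X^-below R (suc a) zero    _   = CommutativeRing.zeroˡ R _
  X^-below R (suc a) (suc n) (ℕ.s≤s n<a) = R.trans
    (R.+-cong (R.zeroˡ _) (R.trans (at (S.*-identityˡ _) n) (X^-below R a n n<a)))
    (R.+-identityˡ _)
    where
    open PowerSeries R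
    module R = CommutativeRing R
    module S = CommutativeRing ring

  -- Congruence modulo q^N, respectively modulo t^N.
  mod-q′ mod-t′ : ℕ → Congruence Q.ring
  mod-q′ N = Coefficientwise.below (equality T.ring) N
  mod-t′ N = Coefficientwise.everywhere (Coefficientwise.below (equality ℤ.+-*-commutativeRing) N)

  mod-q mod-t : ℕ → Congruence Z.ring
  mod-q N = Coefficientwise.everywhere (mod-q′ N)
  mod-t N = Coefficientwise.everywhere (mod-t′ N)

  open Congruence using () renaming (_≅_ to infix 4 _[_≅_])

  q-small : ∀ {N i} j → N ℕ.≤ i → mod-q′ N [ qᵃtᵇ i j ≅ ℤ⟦t,q⟧.0# ]
  q-small {N} {i} j N≤i = ≅-trans
    (*-≅ {y = Q.constant (T.X ℤ⟦t⟧.^ j)}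
         (λ n n<N → X^-below T.ring i n (ℕ.<-≤-trans n<N N≤i)) ≅-refl)
    (≈⇒≅ (ℤ⟦t,q⟧.zeroˡ _))
    where open Congruence (mod-q′ N)

  t-small : ∀ {N} i {j} → N ℕ.≤ j → mod-t′ N [ qᵃtᵇ i j ≅ ℤ⟦t,q⟧.0# ]
  t-small {N} i {j} N≤j = ≅-trans (*-≅ {x = Q.X ℤ⟦t,q⟧.^ i} ≅-refl small) (≈⇒≅ (ℤ⟦t,q⟧.zeroʳ _))
    where
    open Congruence (mod-t′ N)
    small : mod-t′ N [ Q.constant (T.X ℤ⟦t⟧.^ j) ≅ ℤ⟦t,q⟧.0# ]
    small zero    n n<N = X^-below ℤ.+-*-commutativeRing j n (ℕ.<-≤-trans n<N N≤j)
    small (suc _) n n<N = refl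

  factor≅1 : ∀ (E : Congruence Q.ring) k i j → E [ qᵃtᵇ i j ≅ ℤ⟦t,q⟧.0# ] →
             Coefficientwise.everywhere E [ factor k i j ≅ 1ᶻ ]
  factor≅1 E k i j small = Congruence.^-≅1 (Coefficientwise.everywhere E) (exponent k i j) geometric
    where
    open Congruence E
    geometric : Coefficientwise.everywhere E [ Z.1/1- (qᵃtᵇ i j) X ≅ 1ᶻ ]
    geometric zero    = ≅-refl
    geometric (suc m) = ≅-trans (*-≅ {y = qᵃtᵇ i j ℤ⟦t,q⟧.^ m} small ≅-refl)
      (≈⇒≅ (ℤ⟦t,q⟧.zeroˡ _))

  module Stabilise (E : Congruence Z.ring) (F : ℕ → Z.Series) where
    open Congruence E

    ∏<≅1 : (∀ m → F m ≅ 1ᶻ) → ∀ m → ∏< m F ≅ 1ᶻ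
    ∏<≅1 p zero    = ≅-refl
    ∏<≅1 p (suc m) = ≅-trans (*-≅ (∏<≅1 p m) (p m)) (≈⇒≅ (ℤ⟦t,q,z⟧.*-identityˡ _))

    stable : ∀ N → (∀ m → N ℕ.≤ m → F m ≅ 1ᶻ) → ∀ {m} → N ℕ.≤′ m → ∏< m F ≅ ∏< N F
    stable N p ℕ.≤′-refl = ≅-refl
    stable N p (ℕ.≤′-step {n = m} N≤m) = ≅-trans
      (*-≅ (stable N p N≤m) (p m (ℕ.≤′⇒≤ N≤m))) (≈⇒≅ (ℤ⟦t,q,z⟧.*-identityʳ _))

open Truncation

abstract
  inner-multipliable : ∀ k i → Multipliable (factor k i)
  inner-multipliable k i n a b = suc b , λ m b<m →
    Stabilise.stable (mod-t (suc b)) (factor k i) (suc b)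
      (λ j b<j → factor≅1 (mod-t′ (suc b)) k i j (t-small i b<j))
      (ℕ.≤⇒≤′ b<m) n a b ℕ.≤-refl

row : ℕ → ℕ → Z.Series
row k i = ∏∞ (factor k i) (inner-multipliable k i)

abstract
  outer-multipliable : ∀ k → Multipliable (row k)
  outer-multipliable k n a b = suc a , λ m a<m →
    at (Stabilise.stable (mod-q (suc a)) (row k) (suc a)
      (λ i a<i n′ a′ a′<N → mk≋ λ b′ → at (Stabilise.∏<≅1 (mod-q (suc a)) (factor k i)
        (λ j → factor≅1 (mod-q′ (suc a)) k i j (q-small j a<i))
        (proj₁ (inner-multipliable k i n′ a′ b′)) n′ a′ a′<N) b′)
      (ℕ.≤⇒≤′ a<m) n a ℕ.≤-refl) b
    where open T

-- ∏_{i≥0} ∏_{j≥0} 1/(1 − z qⁱ tʲ)^(exponent k i j)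
generatingFunction : ℕ → Z.Series
generatingFunction k = ∏∞ (row k) (outer-multipliable k)

module _ (K : CommutativeRing 0ℓ 0ℓ) where

  private module K = CommutativeRing K

  module _ (V : LeftModule K.ring 0ℓ 0ℓ) where

    open LeftModule V
    open CommutativeMonoidSum +ᴹ-commutativeMonoid using (sum)

    combination : ∀ {d} → Vector K.Carrier d → Vector Carrierᴹ d → Carrierᴹ
    combination c b = sum (λ i → c i *ₗ b i)

    record IsBasis {d} (b : Vector Carrierᴹ d) : Set where
      field
        independent : ∀ c → combination c b ≈ᴹ 0ᴹ → ∀ i → c i K.≈ K.0#
        spanning    : ∀ v → ∃[ c ] v ≈ᴹ combination c b

    HasDimension : ℕ → Set
    HasDimension d = Σ (Vector Carrierᴹ d) IsBasis

open CommutativeMonoidSum ℕ.+-0-commutativeMonoid using (sum-syntax; sum-cong-≗; sum-permute)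

module _ {n k : ℕ} where

  -- Entry (i , j) of an exponent matrix is the exponent of x_ij.
  degree : Vec (Vec ℕ k) n → ℕ
  degree e = ∑[ i < n ] ∑[ j < k ] lookup (lookup e i) j

  permuteRows : Permutation′ n → Vec (Vec ℕ k) n → Vec (Vec ℕ k) n
  permuteRows σ e = tabulate (λ i → lookup e (σ ⟨$⟩ˡ i))

  degree-permuteRows : ∀ σ e → degree (permuteRows σ e) ≡ degree e
  degree-permuteRows σ e = trans
    (sum-cong-≗ {n} (λ i → cong (λ e → ∑[ j < k ] lookup e j)
      (lookup∘tabulate (λ i → lookup e (σ ⟨$⟩ˡ i)) i)))
    (sym (sum-permute (λ i → ∑[ j < k ] lookup (lookup e i) j) (flip σ)))

  _≟ᵥ_ : (p q : Fin n × Fin k) → Dec (p ≡ q)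
  _≟ᵥ_ = ≡-dec Fin._≟_ Fin._≟_

  wordExponents : ∀ {r} → Vec (Fin n × Fin k) r → Vec (Vec ℕ k) n
  wordExponents w = tabulate λ i → tabulate λ j → count (_≟ᵥ (i , j)) w

  -- σ · x_{i₁j₁} ⋯ x_{iᵣjᵣ} = x_{σ(i₁)j₁} ⋯ x_{σ(iᵣ)jᵣ}
  permuteRows-word : ∀ {r} σ (w : Vec (Fin n × Fin k) r) →
    permuteRows σ (wordExponents w) ≡ wordExponents (Vec.map (map₁ (σ ⟨$⟩ʳ_)) w)
  permuteRows-word σ w = tabulate-cong λ i →
    trans (lookup∘tabulate _ (σ ⟨$⟩ˡ i)) (tabulate-cong λ j → go i j w)
    where
    go : ∀ {r} i j (w : Vec (Fin n × Fin k) r) →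
      count (_≟ᵥ (σ ⟨$⟩ˡ i , j)) w ≡ count (_≟ᵥ (i , j)) (Vec.map (map₁ (σ ⟨$⟩ʳ_)) w)
    go i j [] = refl
    go i j ((a , b) ∷ w)
      with (a , b) ≟ᵥ (σ ⟨$⟩ˡ i , j) | (σ ⟨$⟩ʳ a , b) ≟ᵥ (i , j)
    ... | yes _    | yes _    = cong suc (go i j w)
    ... | no  _    | no  _    = go i j w
    ... | yes refl | no  ≢    = contradiction (cong (_, b) (inverseʳ σ)) ≢
    ... | no  ≢    | yes refl = contradiction (cong (_, b) (sym (inverseˡ σ))) ≢

record Monomial (n k r : ℕ) : Set where
  constructor monomial
  field
    exponents    : Vec (Vec ℕ k) n
    .homogeneous : degree exponents ≡ r

infixr 7 _•_

_•_ : ∀ {n k r} → Permutation′ n → Monomial n k r → Monomial n k r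
σ • monomial e p = monomial (permuteRows σ e) (trans (degree-permuteRows σ e) p)

module HomogeneousPolynomials (K : CommutativeRing 0ℓ 0ℓ) (n k r : ℕ) where

  private module K = CommutativeRing K
  open RingProperties K.ring using (-0#≈0#; -‿distribʳ-*; -‿+-comm)

  -- A polynomial is its family of coefficients; there are only finitely
  -- many monomials of degree r.
  Poly : Set
  Poly = Monomial n k r → K.Carrier

  𝒫 : LeftModule K.ring 0ℓ 0ℓ
  𝒫 = record
    { Carrierᴹ = Poly
    ; _≈ᴹ_     = λ f g → ∀ m → f m K.≈ g m
    ; _+ᴹ_     = λ f g m → f m K.+ g m
    ; _*ₗ_     = λ c f m → c K.* f m
    ; 0ᴹ       = λ _ → K.0#
    ; -ᴹ_      = λ f m → K.- f m
    ; isLeftModule = record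
      { isLeftSemimodule = record
        { +ᴹ-isCommutativeMonoid =
            CommutativeRing.+-isCommutativeMonoid (Pointwise.commutativeRing (Monomial n k r) K)
        ; isPreleftSemimodule = record
          { *ₗ-cong      = λ c≈d f≈g m → K.*-cong c≈d (f≈g m)
          ; *ₗ-zeroˡ     = λ f m → K.zeroˡ (f m)
          ; *ₗ-distribʳ  = λ f c d m → K.distribʳ (f m) c d
          ; *ₗ-identityˡ = λ f m → K.*-identityˡ (f m)
          ; *ₗ-assoc     = λ c d f m → K.*-assoc c d (f m)
          ; *ₗ-zeroʳ     = λ c m → K.zeroʳ c
          ; *ₗ-distribˡ  = λ c f g m → K.distribˡ c (f m) (g m)
          }
        }
      ; -ᴹ‿cong    = λ f≈g m → K.-‿cong (f≈g m)
      ; -ᴹ‿inverse = (λ f m → K.-‿inverseˡ (f m)) , (λ f m → K.-‿inverseʳ (f m))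
      }
    }

  open LeftModule 𝒫
  open LeftModuleMorphisms rawLeftModule rawLeftModule using (IsLeftModuleHomomorphism)

  -- The linear extension of the action on monomials: σ · Σ f(m) m is
  -- Σ f(m) (σ • m), whose coefficient at m is f(σ⁻¹ • m).
  _·_ : Permutation′ n → Poly → Poly
  (σ · f) m = f (flip σ • m)

  record Endomorphism : Set where
    field
      ⟦_⟧      : Poly → Poly
      linear   : IsLeftModuleHomomorphism ⟦_⟧
      commutes : ∀ σ f → ⟦ σ · f ⟧ ≈ᴹ σ · ⟦ f ⟧

    open IsLeftModuleHomomorphism linear public

  open Endomorphism

  endomorphism : (φ : Poly → Poly) →
    (∀ {f g} → f ≈ᴹ g → φ f ≈ᴹ φ g) →
    (∀ f g → φ (f +ᴹ g) ≈ᴹ φ f +ᴹ φ g) →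
    (∀ c f → φ (c *ₗ f) ≈ᴹ c *ₗ φ f) →
    (∀ σ f → φ (σ · f) ≈ᴹ σ · φ f) → Endomorphism
  endomorphism φ φ-cong φ-+ φ-* φ-σ = record
    { ⟦_⟧ = φ
    ; linear = record
      { +ᴹ-isGroupHomomorphism = record
        { isMonoidHomomorphism = record
          { isMagmaHomomorphism = record
            { isRelHomomorphism = record { cong = φ-cong }
            ; homo = φ-+
            }
          ; ε-homo = λ m → K.trans (φ-cong (λ m → K.sym (K.zeroˡ K.0#)) m)
              (K.trans (φ-* K.0# 0ᴹ m) (K.zeroˡ _))
          }
        ; ⁻¹-homo = λ f m → K.trans (φ-cong (λ m → K.sym (-1*x≈-x (f m))) m)
            (K.trans (φ-* (K.- K.1#) f m) (-1*x≈-x (φ f m)))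
        }
      ; *ₗ-homo = φ-*
      }
    ; commutes = φ-σ
    }
    where open RingProperties K.ring using (-1*x≈-x)

  -- End_{KSₙ}(𝒫); only its vector space structure matters for the dimension.
  EndSₙ : LeftModule K.ring 0ℓ 0ℓ
  EndSₙ = record
    { Carrierᴹ = Endomorphism
    ; _≈ᴹ_     = λ φ ψ → ∀ f → ⟦ φ ⟧ f ≈ᴹ ⟦ ψ ⟧ f
    ; _+ᴹ_     = λ φ ψ → endomorphism (λ f → ⟦ φ ⟧ f +ᴹ ⟦ ψ ⟧ f)
        (λ p m → K.+-cong (⟦⟧-cong φ p m) (⟦⟧-cong ψ p m))
        (λ f g m → K.trans (K.+-cong (+ᴹ-homo φ f g m) (+ᴹ-homo ψ f g m)) (interchange _ _ _ _))
        (λ c f m → K.trans (K.+-cong (*ₗ-homo φ c f m) (*ₗ-homo ψ c f m))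
                     (K.sym (K.distribˡ c _ _)))
        (λ σ f m → K.+-cong (commutes φ σ f m) (commutes ψ σ f m))
    ; _*ₗ_     = λ c φ → endomorphism (λ f → c *ₗ ⟦ φ ⟧ f)
        (λ p m → K.*-congˡ (⟦⟧-cong φ p m))
        (λ f g m → K.trans (K.*-congˡ (+ᴹ-homo φ f g m)) (K.distribˡ c _ _))
        (λ d f m → K.trans (K.*-congˡ (*ₗ-homo φ d f m)) (x∙yz≈y∙xz c d _))
        (λ σ f m → K.*-congˡ (commutes φ σ f m))
    ; 0ᴹ       = endomorphism (λ _ → 0ᴹ)
        (λ _ _ → K.refl)
        (λ _ _ _ → K.sym (K.+-identityˡ K.0#))
        (λ c _ _ → K.sym (K.zeroʳ c))
        (λ _ _ _ → K.refl)
    ; -ᴹ_      = λ φ → endomorphism (λ f → -ᴹ ⟦ φ ⟧ f)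
        (λ p m → K.-‿cong (⟦⟧-cong φ p m))
        (λ f g m → K.trans (K.-‿cong (+ᴹ-homo φ f g m)) (K.sym (-‿+-comm _ _)))
        (λ c f m → K.trans (K.-‿cong (*ₗ-homo φ c f m)) (-‿distribʳ-* c _))
        (λ σ f m → K.-‿cong (commutes φ σ f m))
    ; isLeftModule = record
      { isLeftSemimodule = record
        { +ᴹ-isCommutativeMonoid = record
          { isMonoid = record
            { isSemigroup = record
              { isMagma = record
                { isEquivalence = record
                  { refl  = λ _ _ → K.refl
                  ; sym   = λ p f m → K.sym (p f m)
                  ; trans = λ p q f m → K.trans (p f m) (q f m)
                  }
                ; ∙-cong = λ p q f m → K.+-cong (p f m) (q f m)
                }
              ; assoc = λ _ _ _ _ _ → K.+-assoc _ _ _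
              }
            ; identity = (λ _ _ _ → K.+-identityˡ _) , (λ _ _ _ → K.+-identityʳ _)
            }
          ; comm = λ _ _ _ _ → K.+-comm _ _
          }
        ; isPreleftSemimodule = record
          { *ₗ-cong      = λ c≈d p f m → K.*-cong c≈d (p f m)
          ; *ₗ-zeroˡ     = λ _ _ _ → K.zeroˡ _
          ; *ₗ-distribʳ  = λ _ _ _ _ _ → K.distribʳ _ _ _
          ; *ₗ-identityˡ = λ _ _ _ → K.*-identityˡ _
          ; *ₗ-assoc     = λ _ _ _ _ _ → K.*-assoc _ _ _
          ; *ₗ-zeroʳ     = λ _ _ _ → K.zeroʳ _
          ; *ₗ-distribˡ  = λ _ _ _ _ _ → K.distribˡ _ _ _
          }
        }
      ; -ᴹ‿cong    = λ p f m → K.-‿cong (p f m)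
      ; -ᴹ‿inverse = (λ _ _ _ → K.-‿inverseˡ _) , (λ _ _ _ → K.-‿inverseʳ _)
      }
    }
    where
    open CommutativeSemigroupProperties K.+-commutativeSemigroup using (interchange)
    open CommutativeSemigroupProperties K.*-commutativeSemigroup using (x∙yz≈y∙xz)

𝒜 : (r k n : ℕ) → LeftModule (CommutativeRing.ring ℂ-ring) 0ℓ 0ℓ
𝒜 r k n = HomogeneousPolynomials.EndSₙ ℂ-ring n k r

{-# OPTIONS --safe #-}

-- Sₙ permutes the monomial basis of 𝒫, so an endomorphism commutes
-- with Sₙ iff its matrix is constant on the Sₙ-orbits of pairs of monomials, and the
-- orbit indicators form a basis.  Read row by row, a pair of n × k exponent matrices
-- is a word of length n in "colours" (x , y) ∈ ℕᵏ × ℕᵏ, on which Sₙ permutes the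
-- letters; hence orbits are multisets of n colours whose bidegrees (|x| , |y|) add up
-- to (r , r).  Their generating function is ∏ 1/(1 − z q^|x| t^|y|) over all colours,
-- and there are C(k+i−1, i) vectors x with |x| = i.

module Submission where

open import Defs
open import Algebra.Bundles using (CommutativeRing)
open import Algebra.Module.Bundles using (LeftModule)
import Algebra.Properties.CommutativeMonoid.Sum as CommutativeMonoidSum
import Algebra.Properties.CommutativeSemigroup as CommutativeSemigroupProperties
import Algebra.Properties.CommutativeSemiring.Exp as CommutativeSemiringExp
import Algebra.Properties.Semiring.Exp as SemiringExp
import Algebra.Properties.Semiring.Sum as SemiringSum
open import Data.Bool.Base using (Bool; true; false; if_then_else_; _∧_)
open import Data.Bool.Properties using (if-float)
open import Data.Fin.Base using (Fin; zero; suc; cast; punchIn)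
open import Data.Fin.Permutation using (Permutation′; _⟨$⟩ʳ_; _⟨$⟩ˡ_; _∘ₚ_; flip; remove;
  cast-id; permutation; inverseˡ; punchIn-permute)
import Data.Fin.Properties as Fin
open import Data.Integer.Base as ℤ using (+_)
import Data.Integer.Properties as ℤ
open import Data.List.Base as List
  using (List; []; _∷_; _++_; length; filter; cartesianProduct; cartesianProductWith)
open import Data.List.Membership.Propositional using (_∈_; find; lose)
open import Data.List.Membership.Propositional.Properties using (∈-map⁺; ∈-++⁺ˡ; ∈-++⁺ʳ;
  ∈-cartesianProduct⁺; ∈-cartesianProductWith⁺; ∈-filter⁺; ∈-lookup)
open import Data.List.Properties using (length-map; length-++)
open import Data.List.Relation.Binary.Permutation.Homogeneous using (onIndices)
open import Data.List.Relation.Binary.Permutation.Propositional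
  using (_↭_; ↭-refl; ↭-sym; ↭-trans; ↭-reflexive; prep; swap; ↭⇒↭ₛ)
import Data.List.Relation.Binary.Permutation.Propositional.Properties as ↭
import Data.List.Relation.Binary.Permutation.Setoid.Properties as ↭ₛ
open import Data.List.Relation.Unary.All as All using (All; []; _∷_)
import Data.List.Relation.Unary.All.Properties as All
open import Data.List.Relation.Unary.AllPairs as AllPairs using (AllPairs; []; _∷_)
import Data.List.Relation.Unary.AllPairs.Properties as AllPairs
open import Data.List.Relation.Unary.Any as Any using (Any; here; there; any?)
import Data.List.Relation.Unary.Any.Properties as Any
open import Data.List.Relation.Unary.Unique.Propositional using (Unique)
import Data.List.Relation.Unary.Unique.Propositional.Properties as Unique
open import Data.Nat.Base as ℕ using (ℕ; zero; suc; _≤_; _<_; s≤s; _⊔_; NonZero)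
open import Data.Nat.Combinatorics using (_C_; nCk+nC[k+1]≡[n+1]C[k+1]; k>n⇒nCk≡0)
import Data.Nat.ListAction as ℕ
import Data.Nat.ListAction.Properties as ℕ
import Data.Nat.Properties as ℕ
open import Data.Product.Base using (∃-syntax; _×_; _,_; proj₁; proj₂)
open import Data.Product.Properties using (≡-dec)
open import Data.Sum.Base using (inj₁; inj₂; [_,_]′)
open import Data.Vec.Base as Vec using (Vec; []; _∷_; lookup; removeAt; tabulate; toList; zip)
open import Data.Vec.Functional using (Vector)
open import Data.Vec.Properties as Vec using (length-toList; lookup-zip; lookup∘tabulate;
  map-id; map-∘; map-<,>-zip; map-proj₁-zip; map-proj₂-zip; tabulate-cong; tabulate∘lookup; ∷-injective)
open import Function.Base using (_∘_)
open import Function.Bundles using (_↔_; Inverse; mk⇔; mk↔ₛ′)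
open import Level using (0ℓ)
open import Relation.Binary.Definitions using (DecidableEquality; Symmetric)
open import Relation.Binary.PropositionalEquality
  using (_≡_; refl; sym; trans; cong; cong₂; subst; setoid; module ≡-Reasoning)
import Relation.Binary.Reasoning.Setoid as SetoidReasoning
open import Relation.Nullary using (¬_; Dec; does; contradiction)
open import Relation.Nullary.Decidable using (_×-dec_; does-⇔; recompute; toSum)
open import Relation.Unary using (Pred; Decidable)

-- Equivariant endomorphisms

-- The basis argument needs no averaging over the group and no decision in the coefficient ring,
-- where equality of complex numbers is undecidable: only monomials and labels are compared, so it
-- works over any commutative ring. Two pairs with the same label must be related by one permutation
-- acting on both members. Zipping a pair into a single word before passing to its multiset
-- guarantees this. The count needs no bijection between two index sets. `multisets` follows the
-- recursion h(n+1; x, xs) = h(n+1; xs) + x h(n; x, xs) of the complete homogeneous symmetric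
-- polynomials, which is also the recursion for the coefficients of a product of geometric series.
-- The list that numbers the basis is thus the filtered form of the list that is summed in the
-- coefficient. There are infinitely many colours, so both sides use only those whose two degrees
-- are below a cut-off m > r; no letter of a word of bidegree (r, r) is lost. The cut-off is
-- supplied by the convergence of the infinite product, so the list of orbits carries it as a
-- parameter.

monomial-≡ : ∀ {n k r} {m p : Monomial n k r} →
  Monomial.exponents m ≡ Monomial.exponents p → m ≡ p
monomial-≡ refl = refl

permuteRows-flip : ∀ {n k} σ (e : Vec (Vec ℕ k) n) → permuteRows (flip σ) (permuteRows σ e) ≡ e
permuteRows-flip σ e = trans
  (tabulate-cong λ i → trans (lookup∘tabulate _ (σ ⟨$⟩ʳ i)) (cong (lookup e) (inverseˡ σ)))
  (tabulate∘lookup e)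

flip-• : ∀ {n k r} σ (m : Monomial n k r) → flip σ • σ • m ≡ m
flip-• σ m = monomial-≡ (permuteRows-flip σ (Monomial.exponents m))

•-flip : ∀ {n k r} σ (m : Monomial n k r) → σ • flip σ • m ≡ m
•-flip σ m = monomial-≡ (permuteRows-flip (flip σ) (Monomial.exponents m))

-- A numbering of the Sₙ-orbits of pairs of monomials.
record OrbitalLabelling (n k r d : ℕ) : Set where
  field
    label     : Monomial n k r → Monomial n k r → Fin d
    invariant : ∀ σ m p → label (σ • m) (σ • p) ≡ label m p
    separates : ∀ {m p m′ p′} → label m p ≡ label m′ p′ → ∃[ σ ] m′ ≡ σ • m × p′ ≡ σ • p
    repˡ repʳ : Fin d → Monomial n k r
    label-rep : ∀ o → label (repˡ o) (repʳ o) ≡ o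

module EquivariantBasis
  (K : CommutativeRing 0ℓ 0ℓ) {n k r d N : ℕ}
  (enumeration : Fin N ↔ Monomial n k r) (L : OrbitalLabelling n k r d) where

  open CommutativeRing K using (Carrier; _≈_; _+_; _*_; 0#; 1#; +-cong; *-congˡ; *-congʳ;
    +-identityˡ; +-identityʳ; zeroˡ; zeroʳ; *-identityˡ; *-identityʳ; *-comm; *-assoc; distribˡ)
  private module K = CommutativeRing K
  open CommutativeMonoidSum K.+-commutativeMonoid using (sum-cong-≋; sum-cong-≗;
    sum-replicate-zero; sum-permute; sum-syntax; ∑-comm; ∑-distrib-+)
  open SemiringSum K.semiring using (*-distribˡ-sum; *-distribʳ-sum)
  open CommutativeSemigroupProperties K.*-commutativeSemigroup using (x∙yz≈y∙xz)
  open SetoidReasoning K.setoid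
  open HomogeneousPolynomials K n k r
  open Endomorphism
  open OrbitalLabelling L
  open LeftModule 𝒫 using (_≈ᴹ_)

  private
    M : Set
    M = Monomial n k r

    at : Fin N → M
    at = Inverse.to enumeration

    index : M → Fin N
    index = Inverse.from enumeration

    at-index : ∀ m → at (index m) ≡ m
    at-index m = Inverse.inverseˡ enumeration refl

    index-at : ∀ l → index (at l) ≡ l
    index-at l = Inverse.inverseʳ enumeration refl

  indicator : Bool → Carrier
  indicator true  = 1#
  indicator false = 0#

  sum-indicator : ∀ {s} (j : Fin s) (f : Vector Carrier s) →
    ∑[ i < s ] (indicator (does (j Fin.≟ i)) * f i) ≈ f j
  sum-indicator {suc s} zero f = begin
    1# * f zero + ∑[ i < s ] (0# * f (suc i))
      ≈⟨ +-cong (*-identityˡ _) (K.trans (sum-cong-≋ λ i → zeroˡ (f (suc i))) (sum-replicate-zero s)) ⟩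
    f zero + 0#  ≈⟨ +-identityʳ _ ⟩
    f zero       ∎
  sum-indicator {suc s} (suc j) f = begin
    0# * f zero + ∑[ i < s ] (indicator (does (j Fin.≟ i)) * f (suc i))
      ≈⟨ +-cong (zeroˡ _) (sum-indicator j (f ∘ suc)) ⟩
    0# + f (suc j)  ≈⟨ +-identityˡ _ ⟩
    f (suc j)       ∎

  Δ : M → Poly
  Δ m p = indicator (does (index m Fin.≟ index p))

  sum-Δ : ∀ (f : Poly) p → ∑[ l < N ] (f (at l) * Δ (at l) p) ≈ f p
  sum-Δ f p = begin
    ∑[ l < N ] (f (at l) * Δ (at l) p)
      ≈⟨ sum-cong-≋ (λ l → K.trans (*-comm _ _) (*-congʳ (K.reflexive (cong indicator
           (does-⇔ (mk⇔ (λ q → trans (sym q) (index-at l)) (λ q → trans (index-at l) (sym q)))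
             (index (at l) Fin.≟ index p) (index p Fin.≟ l)))))) ⟩
    ∑[ l < N ] (indicator (does (index p Fin.≟ l)) * f (at l))  ≈⟨ sum-indicator (index p) (f ∘ at) ⟩
    f (at (index p))                                            ≡⟨ cong f (at-index p) ⟩
    f p                                                         ∎

  ·-Δ : ∀ σ m → σ · Δ m ≈ᴹ Δ (σ • m)
  ·-Δ σ m p = K.reflexive (cong indicator (does-⇔
    (mk⇔ (λ q → cong index (trans (cong (σ •_) (index-injective q)) (•-flip σ p)))
         (λ q → cong index (trans (sym (flip-• σ m)) (cong (flip σ •_) (index-injective q)))))
    (index m Fin.≟ index (flip σ • p)) (index (σ • m) Fin.≟ index p)))
    where
    index-injective : ∀ {m p} → index m ≡ index p → m ≡ p
    index-injective {m} {p} q = trans (sym (at-index m)) (trans (cong at q) (at-index p))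

  sum-• : ∀ σ (F : M → Carrier) → ∑[ l < N ] F (σ • at l) ≈ ∑[ l < N ] F (at l)
  sum-• σ F = K.sym (K.trans (sum-permute (F ∘ at) π)
    (K.reflexive (sum-cong-≗ {N} λ l → cong F (at-index (σ • at l)))))
    where
    π : Permutation′ N
    π = permutation (λ l → index (σ • at l)) (λ l → index (flip σ • at l))
      (λ l → trans (cong (λ m → index (σ • m)) (at-index _)) (trans (cong index (•-flip σ _)) (index-at l)))
      (λ l → trans (cong (λ m → index (flip σ • m)) (at-index _)) (trans (cong index (flip-• σ _)) (index-at l)))

  kernel-operator : (M → M → Carrier) → Poly → Poly
  kernel-operator c f m = ∑[ l < N ] (c m (at l) * f (at l))

  -- The operator whose matrix is the 0-1 indicator of one orbit of pairs, known as the adjacency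
  -- matrix of an orbital.
  orbital : Fin d → Endomorphism
  orbital o = endomorphism (kernel-operator c)
    (λ f≈g m → sum-cong-≋ λ l → *-congˡ (f≈g (at l)))
    (λ f g m → K.trans (sum-cong-≋ {N} λ l → distribˡ (c m (at l)) (f (at l)) (g (at l)))
      (∑-distrib-+ (λ l → c m (at l) * f (at l)) (λ l → c m (at l) * g (at l))))
    (λ a f m → K.trans (sum-cong-≋ {N} λ l → x∙yz≈y∙xz (c m (at l)) a (f (at l)))
      (K.sym (*-distribˡ-sum a (λ l → c m (at l) * f (at l)))))
    -- Invariance moves the inverse of `σ` onto both arguments of the kernel; as it permutes the
    -- monomials, the sum can then be reindexed.
    (λ σ f m → K.trans
      (sum-cong-≋ λ l → *-congʳ (K.reflexive (cong (λ i → indicator (does (i Fin.≟ o)))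
        (sym (invariant (flip σ) m (at l))))))
      (sum-• (flip σ) (λ p → c (flip σ • m) p * f p)))
    where
    c : M → M → Carrier
    c m p = indicator (does (label m p Fin.≟ o))

  combination-apply : ∀ {s} (c : Vector Carrier s) (b : Vector Endomorphism s) f m →
    ⟦ combination K EndSₙ c b ⟧ f m ≈ ∑[ i < s ] (c i * ⟦ b i ⟧ f m)
  combination-apply {zero}  c b f m = K.refl
  combination-apply {suc s} c b f m = +-cong K.refl (combination-apply (c ∘ suc) (b ∘ suc) f m)

  -- Every pair of monomials lies in exactly one orbit, so after exchanging the two sums the inner
  -- one keeps a single coefficient: the combination has matrix entries `c (label m p)`.
  combination-orbital : ∀ c f m →
    ⟦ combination K EndSₙ c orbital ⟧ f m ≈ ∑[ l < N ] (c (label m (at l)) * f (at l))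
  combination-orbital c f m = begin
    ⟦ combination K EndSₙ c orbital ⟧ f m
      ≈⟨ combination-apply c orbital f m ⟩
    ∑[ o < d ] (c o * ∑[ l < N ] (ι l o * f (at l)))
      ≈⟨ sum-cong-≋ (λ o → *-distribˡ-sum (c o) (λ l → ι l o * f (at l))) ⟩
    ∑[ o < d ] ∑[ l < N ] (c o * (ι l o * f (at l)))
      ≈⟨ ∑-comm (λ o l → c o * (ι l o * f (at l))) ⟩
    ∑[ l < N ] ∑[ o < d ] (c o * (ι l o * f (at l)))
      ≈⟨ sum-cong-≋ {N} (λ l → sum-cong-≋ {d} (λ o →
           K.trans (x∙yz≈y∙xz (c o) (ι l o) _) (K.sym (*-assoc _ _ _)))) ⟩
    ∑[ l < N ] ∑[ o < d ] ((ι l o * c o) * f (at l))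
      ≈⟨ sum-cong-≋ (λ l → *-distribʳ-sum (f (at l)) (λ o → ι l o * c o)) ⟨
    ∑[ l < N ] ((∑[ o < d ] (ι l o * c o)) * f (at l))
      ≈⟨ sum-cong-≋ (λ l → *-congʳ (sum-indicator (label m (at l)) c)) ⟩
    ∑[ l < N ] (c (label m (at l)) * f (at l)) ∎
    where
    ι : Fin N → Fin d → Carrier
    ι l o = indicator (does (label m (at l) Fin.≟ o))

  linear-sum : ∀ (ψ : Endomorphism) {s} (a : Vector Carrier s) (g : Vector Poly s) m →
    ⟦ ψ ⟧ (λ p → ∑[ i < s ] (a i * g i p)) m ≈ ∑[ i < s ] (a i * ⟦ ψ ⟧ (g i) m)
  linear-sum ψ {zero}  a g m = 0ᴹ-homo ψ m
  linear-sum ψ {suc s} a g m = K.trans (+ᴹ-homo ψ _ _ m)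
    (+-cong (*ₗ-homo ψ (a zero) (g zero) m) (linear-sum ψ (a ∘ suc) (g ∘ suc) m))

  -- Some `σ` carries the chosen representatives to `m` and `p`, and moving it through `ψ` by
  -- equivariance cancels it. Here the matrix becomes a function of the label alone.
  matrix-entry : ∀ (ψ : Endomorphism) m p →
    ⟦ ψ ⟧ (Δ p) m ≈ ⟦ ψ ⟧ (Δ (repʳ (label m p))) (repˡ (label m p))
  matrix-entry ψ m p with separates (label-rep (label m p))
  ... | σ , m≡ , p≡ = begin
    ⟦ ψ ⟧ (Δ p) m                  ≡⟨ cong₂ (λ p m → ⟦ ψ ⟧ (Δ p) m) p≡ m≡ ⟩
    ⟦ ψ ⟧ (Δ (σ • y)) (σ • x)      ≈⟨ ⟦⟧-cong ψ (·-Δ σ y) (σ • x) ⟨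
    ⟦ ψ ⟧ (σ · Δ y) (σ • x)        ≈⟨ commutes ψ σ (Δ y) (σ • x) ⟩
    ⟦ ψ ⟧ (Δ y) (flip σ • σ • x)   ≡⟨ cong (⟦ ψ ⟧ (Δ y)) (flip-• σ x) ⟩
    ⟦ ψ ⟧ (Δ y) x                  ∎
    where
    x = repˡ (label m p)
    y = repʳ (label m p)

  hasDimension : HasDimension K EndSₙ d
  hasDimension = orbital , record { independent = independent ; spanning = spanning }
    where
    independent : ∀ c → (∀ f m → ⟦ combination K EndSₙ c orbital ⟧ f m ≈ 0#) → ∀ o → c o ≈ 0#
    -- The coefficient at `o` is the matrix entry at its representative pair: apply the combination
    -- to the monomial `y` and read off the coefficient of `x`.
    independent c vanishes o = begin
      c o                                                     ≡⟨ cong c (label-rep o) ⟨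
      c (label x y)                                           ≈⟨ sum-Δ (c ∘ label x) y ⟨
      ∑[ l < N ] (c (label x (at l)) * Δ (at l) y)
        ≈⟨ sum-cong-≋ (λ l → *-congˡ (K.reflexive (cong indicator
             (does-⇔ (mk⇔ sym sym) (index (at l) Fin.≟ index y) (index y Fin.≟ index (at l)))))) ⟩
      ∑[ l < N ] (c (label x (at l)) * Δ y (at l))            ≈⟨ combination-orbital c (Δ y) x ⟨
      ⟦ combination K EndSₙ c orbital ⟧ (Δ y) x               ≈⟨ vanishes (Δ y) x ⟩
      0#                                                      ∎
      where
      x = repˡ o
      y = repʳ o

    spanning : ∀ ψ → ∃[ c ] (∀ f → ⟦ ψ ⟧ f ≈ᴹ ⟦ combination K EndSₙ c orbital ⟧ f)
    spanning ψ = c , λ f m → begin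
      ⟦ ψ ⟧ f m
        ≈⟨ ⟦⟧-cong ψ (sum-Δ f) m ⟨
      ⟦ ψ ⟧ (λ p → ∑[ l < N ] (f (at l) * Δ (at l) p)) m
        ≈⟨ linear-sum ψ (f ∘ at) (Δ ∘ at) m ⟩
      ∑[ l < N ] (f (at l) * ⟦ ψ ⟧ (Δ (at l)) m)
        ≈⟨ sum-cong-≋ (λ l → K.trans (*-comm _ _) (*-congʳ (matrix-entry ψ m (at l)))) ⟩
      ∑[ l < N ] (c (label m (at l)) * f (at l))
        ≈⟨ combination-orbital c f m ⟨
      ⟦ combination K EndSₙ c orbital ⟧ f m ∎
      where
      c : Vector Carrier d
      -- The coordinate on an orbit is the entry of `ψ` in row `repˡ o` and column `repʳ o`.
      c o = ⟦ ψ ⟧ (Δ (repʳ o)) (repˡ o)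

-- Multisets as words up to permutation

infix 4 _≋_

_≋_ : ∀ {A : Set} {n} → Vec A n → Vec A n → Set
v ≋ w = toList v ↭ toList w

-- Agrees by computation with `permuteRows` when the letters are rows, but also acts on the zipped
-- word of a pair.
permute : ∀ {A : Set} {n} → Permutation′ n → Vec A n → Vec A n
permute σ v = tabulate λ i → lookup v (σ ⟨$⟩ˡ i)

removeAt-≋ : ∀ {A : Set} {n} (v : Vec A (suc n)) i → (lookup v i ∷ removeAt v i) ≋ v
removeAt-≋ (x ∷ v)         zero    = ↭-refl
removeAt-≋ (x ∷ v@(_ ∷ _)) (suc i) = ↭-trans (swap _ x ↭-refl) (prep x (removeAt-≋ v i))

lookup-punchIn : ∀ {A : Set} {n} (v : Vec A (suc n)) i j → lookup v (punchIn i j) ≡ lookup (removeAt v i) j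
lookup-punchIn (x ∷ v)         zero    j       = refl
lookup-punchIn (x ∷ v@(_ ∷ _)) (suc i) zero    = refl
lookup-punchIn (x ∷ v@(_ ∷ _)) (suc i) (suc j) = lookup-punchIn v i j

-- By induction on the length: the first letter is the one at position `π 0`, and the others are the
-- remaining letters rearranged by `remove zero π`.
rearrange-≋ : ∀ {A : Set} {n} (π : Permutation′ n) (v : Vec A n) →
  tabulate (λ i → lookup v (π ⟨$⟩ʳ i)) ≋ v
rearrange-≋ {n = zero}  π [] = ↭-refl
rearrange-≋ {n = suc n} π v  = ↭-trans
  (prep _ (subst (λ w → w ≋ removeAt v i)
    (tabulate-cong λ j → sym (trans (cong (lookup v) (punchIn-permute π zero j)) (lookup-punchIn v i _)))
    (rearrange-≋ (remove zero π) (removeAt v i))))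
  (removeAt-≋ v i)
  where
  i = π ⟨$⟩ʳ zero

permute-≋ : ∀ {A : Set} {n} σ (v : Vec A n) → permute σ v ≋ v
permute-≋ σ = rearrange-≋ (flip σ)

lookup-toList : ∀ {A : Set} {n} (v : Vec A n) i →
  List.lookup (toList v) i ≡ lookup v (cast (length-toList v) i)
lookup-toList (x ∷ v) zero    = refl
lookup-toList (x ∷ v) (suc i) = lookup-toList v i

lookup-toList′ : ∀ {A : Set} {n} (v : Vec A n) i →
  List.lookup (toList v) (cast (sym (length-toList v)) i) ≡ lookup v i
lookup-toList′ (x ∷ v) zero    = refl
lookup-toList′ (x ∷ v) (suc i) = lookup-toList′ v i

≋⇒permute : ∀ {A : Set} {n} {v w : Vec A n} → v ≋ w → ∃[ σ ] w ≡ permute σ v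
-- The permutation proof is read as a bijection from positions of `w` to positions of `v`. It is
-- flipped because `permute` looks letters up through the inverse.
≋⇒permute {A} {n} {v} {w} v≋w = flip π , trans (sym (tabulate∘lookup w)) (tabulate-cong λ i →
  trans (sym (lookup-toList′ w i)) (trans (↭ₛ.onIndices-lookup (setoid A) w↭v _) (lookup-toList v _)))
  where
  w↭v = ↭⇒↭ₛ (↭-sym v≋w)
  π : Permutation′ n
  π = cast-id (sym (length-toList w)) ∘ₚ onIndices w↭v ∘ₚ cast-id (length-toList v)

module _ {A : Set} where

  -- Each multiset appears once, its letters listed in the order of xs.
  multisets : List A → ∀ n → List (Vec A n)
  multisets xs       zero    = [] ∷ []
  multisets []       (suc n) = []
  multisets (x ∷ xs) (suc n) = multisets xs (suc n) ++ List.map (x ∷_) (multisets (x ∷ xs) n)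

  multisets-⊆ : ∀ xs n → All (λ v → All (_∈ xs) (toList v)) (multisets xs n)
  multisets-⊆ xs       zero    = [] ∷ []
  multisets-⊆ []       (suc n) = []
  multisets-⊆ (x ∷ xs) (suc n) = All.++⁺
    (All.map (All.map there) (multisets-⊆ xs (suc n)))
    (All.map⁺ (All.map (here refl ∷_) (multisets-⊆ (x ∷ xs) n)))

  -- Words of the second half contain `x` and those of the first half do not, as `x` does not recur
  -- in `xs`; within the second half the common `x` cancels.
  multisets-distinct : ∀ {xs} n → Unique xs → AllPairs (λ v w → ¬ v ≋ w) (multisets xs n)
  multisets-distinct {xs}     zero    xs! = [] ∷ []
  multisets-distinct {[]}     (suc n) xs! = []
  multisets-distinct {x ∷ xs} (suc n) xs! = AllPairs.++⁺
    (multisets-distinct (suc n) (AllPairs.tail xs!))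
    (AllPairs.map⁺ (AllPairs.map (_∘ ↭.drop-∷) (multisets-distinct n xs!)))
    (All.map (λ v⊆xs → All.map⁺ (All.universal (λ w v≋x∷w →
        Unique.Unique[x∷xs]⇒x∉xs xs! (All.lookup v⊆xs (↭.∈-resp-↭ (↭-sym v≋x∷w) (here refl)))) _))
      (multisets-⊆ xs (suc n)))

  ∈⇒∷≋ : ∀ {n x} (v : Vec A (suc n)) → x ∈ toList v → ∃[ w ] (x ∷ w) ≋ v
  ∈⇒∷≋ (x ∷ v)         (here refl) = v , ↭-refl
  ∈⇒∷≋ (y ∷ v@(_ ∷ _)) (there x∈v) with ∈⇒∷≋ v x∈v
  ... | w , x∷w≋v = y ∷ w , ↭-trans (swap _ y ↭-refl) (prep y x∷w≋v)

  -- If `x` occurs in `v`, it is moved to the front and `x` stays available for the shorter rest;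
  -- otherwise `x` is dropped from the alphabet.
  multisets-complete : DecidableEquality A → ∀ {xs n} (v : Vec A n) → All (_∈ xs) (toList v) →
    Any (v ≋_) (multisets xs n)
  multisets-complete _≟_ {xs}     {zero}  []      v⊆xs       = here ↭-refl
  multisets-complete _≟_ {[]}     {suc n} (_ ∷ _) (() ∷ _)
  multisets-complete _≟_ {x ∷ xs} {suc n} v       v⊆x∷xs =
    [ (λ x∈v → let w , x∷w≋v = ∈⇒∷≋ v x∈v in
        Any.++⁺ʳ (multisets xs (suc n)) (Any.map⁺ (Any.map
          (λ w≋u → ↭-trans (↭-sym x∷w≋v) (prep x w≋u))
          (multisets-complete _≟_ w (All.tail (↭.All-resp-↭ (↭-sym x∷w≋v) v⊆x∷xs))))))
    , (λ x∉v → Any.++⁺ˡ (multisets-complete _≟_ v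
        (All.tabulate λ y∈v → Any.tail (λ { refl → x∉v y∈v }) (All.lookup v⊆x∷xs y∈v))))
    ]′ (toSum (any? (x ≟_) (toList v)))

-- Enumerating monomials and orbits

AllPairs⇒lookup-injective : ∀ {A : Set} {R : A → A → Set} → Symmetric R →
  ∀ {xs} → AllPairs (λ x y → ¬ R x y) xs →
  ∀ i j → R (List.lookup xs i) (List.lookup xs j) → i ≡ j
AllPairs⇒lookup-injective R-sym (x# ∷ xs#) zero    zero    r = refl
AllPairs⇒lookup-injective R-sym (x# ∷ xs#) zero    (suc j) r = contradiction r (All.lookup x# (∈-lookup j))
AllPairs⇒lookup-injective R-sym (x# ∷ xs#) (suc i) zero    r = contradiction (R-sym r) (All.lookup x# (∈-lookup i))
AllPairs⇒lookup-injective R-sym (x# ∷ xs#) (suc i) (suc j) r = cong suc (AllPairs⇒lookup-injective R-sym xs# i j r)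

total : ∀ {A : Set} {n} → (A → ℕ) → Vec A n → ℕ
total f v = Vec.sum (Vec.map f v)

total-≥ : ∀ {A : Set} {n} (f : A → ℕ) (v : Vec A n) → All (λ x → f x ≤ total f v) (toList v)
total-≥ f []      = []
total-≥ f (x ∷ v) = ℕ.m≤m+n (f x) _ ∷ All.map (λ le → ℕ.≤-trans le (ℕ.m≤n+m _ (f x))) (total-≥ f v)

total-toList : ∀ {A : Set} {n} (f : A → ℕ) (v : Vec A n) → total f v ≡ ℕ.sum (List.map f (toList v))
total-toList f []      = refl
total-toList f (x ∷ v) = cong (f x ℕ.+_) (total-toList f v)

total-≋ : ∀ {A : Set} {n} (f : A → ℕ) {v w : Vec A n} → v ≋ w → total f v ≡ total f w
total-≋ f {v} {w} v≋w = trans (total-toList f v)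
  (trans (ℕ.sum-↭ (↭.map⁺ f v≋w)) (sym (total-toList f w)))

degree-total : ∀ {n k} (e : Vec (Vec ℕ k) n) → degree e ≡ total Vec.sum e
degree-total []      = refl
degree-total (x ∷ e) = cong₂ ℕ._+_ (sum-lookup x) (degree-total e)
  where
  open CommutativeMonoidSum ℕ.+-0-commutativeMonoid using (sum-syntax)
  sum-lookup : ∀ {k} (x : Vec ℕ k) → ∑[ j < k ] lookup x j ≡ Vec.sum x
  sum-lookup []      = refl
  sum-lookup (a ∷ x) = cong (a ℕ.+_) (sum-lookup x)

incrementHead : ∀ {k} → Vec ℕ (suc k) → Vec ℕ (suc k)
incrementHead (a ∷ x) = suc a ∷ x

-- The split into head zero and positive head matches Pascal's rule, which makes the length a
-- binomial coefficient.
vectorsOfSum : ∀ k → ℕ → List (Vec ℕ k)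
vectorsOfSum zero    zero    = [] ∷ []
vectorsOfSum zero    (suc i) = []
vectorsOfSum (suc k) zero    = List.map (0 ∷_) (vectorsOfSum k zero)
vectorsOfSum (suc k) (suc i) =
  List.map (0 ∷_) (vectorsOfSum k (suc i)) ++ List.map incrementHead (vectorsOfSum (suc k) i)

length-vectorsOfSum : ∀ k i → length (vectorsOfSum k i) ≡ (k ℕ.+ i ℕ.∸ 1) C i
length-vectorsOfSum zero    zero    = refl
-- For `k` = 0 the truncated subtraction leaves `i C suc i`, which vanishes, as it should: the empty
-- vector has sum 0.
length-vectorsOfSum zero    (suc i) = sym (k>n⇒nCk≡0 (ℕ.n<1+n i))
length-vectorsOfSum (suc k) zero    =
  trans (length-map (0 ∷_) (vectorsOfSum k zero)) (length-vectorsOfSum k zero)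
length-vectorsOfSum (suc k) (suc i) = begin
  length (List.map (0 ∷_) (vectorsOfSum k (suc i)) ++ List.map incrementHead (vectorsOfSum (suc k) i))
    ≡⟨ length-++ (List.map (0 ∷_) (vectorsOfSum k (suc i))) ⟩
  length (List.map (0 ∷_) (vectorsOfSum k (suc i)))
    ℕ.+ length (List.map incrementHead (vectorsOfSum (suc k) i))
    ≡⟨ cong₂ ℕ._+_ (length-map _ (vectorsOfSum k (suc i))) (length-map _ (vectorsOfSum (suc k) i)) ⟩
  length (vectorsOfSum k (suc i)) ℕ.+ length (vectorsOfSum (suc k) i)
    ≡⟨ cong₂ ℕ._+_ (length-vectorsOfSum k (suc i)) (length-vectorsOfSum (suc k) i) ⟩
  (k ℕ.+ suc i ℕ.∸ 1) C suc i ℕ.+ (k ℕ.+ i) C i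
    ≡⟨ cong (λ j → (j ℕ.∸ 1) C suc i ℕ.+ (k ℕ.+ i) C i) (ℕ.+-suc k i) ⟩
  (k ℕ.+ i) C suc i ℕ.+ (k ℕ.+ i) C i
    ≡⟨ ℕ.+-comm ((k ℕ.+ i) C suc i) _ ⟩
  (k ℕ.+ i) C i ℕ.+ (k ℕ.+ i) C suc i
    ≡⟨ nCk+nC[k+1]≡[n+1]C[k+1] (k ℕ.+ i) i ⟩
  suc (k ℕ.+ i) C suc i
    ≡⟨ cong (_C suc i) (ℕ.+-suc k i) ⟨
  (k ℕ.+ suc i) C suc i ∎
  where open ≡-Reasoning

vectorsOfSum-sum : ∀ k i → All (λ x → Vec.sum x ≡ i) (vectorsOfSum k i)
vectorsOfSum-sum zero    zero    = refl ∷ []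
vectorsOfSum-sum zero    (suc i) = []
vectorsOfSum-sum (suc k) zero    = All.map⁺ (vectorsOfSum-sum k zero)
vectorsOfSum-sum (suc k) (suc i) = All.++⁺
  (All.map⁺ (vectorsOfSum-sum k (suc i)))
  (All.map⁺ (All.map (λ { {_ ∷ _} → cong suc }) (vectorsOfSum-sum (suc k) i)))

vectorsOfSum-complete : ∀ {k i} (x : Vec ℕ k) → Vec.sum x ≡ i → x ∈ vectorsOfSum k i
vectorsOfSum-complete {zero}  {zero}  []          _    = here refl
vectorsOfSum-complete {suc k} {zero}  (zero  ∷ x) eq   = ∈-map⁺ (0 ∷_) (vectorsOfSum-complete x eq)
vectorsOfSum-complete {suc k} {suc i} (zero  ∷ x) eq   = ∈-++⁺ˡ (∈-map⁺ (0 ∷_) (vectorsOfSum-complete x eq))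
vectorsOfSum-complete {suc k} {suc i} (suc a ∷ x) eq   = ∈-++⁺ʳ (List.map (0 ∷_) (vectorsOfSum k (suc i)))
  (∈-map⁺ incrementHead (vectorsOfSum-complete (a ∷ x) (ℕ.suc-injective eq)))

vectorsOfSum-unique : ∀ k i → Unique (vectorsOfSum k i)
vectorsOfSum-unique zero    zero    = [] ∷ []
vectorsOfSum-unique zero    (suc i) = []
vectorsOfSum-unique (suc k) zero    = Unique.map⁺ (λ { refl → refl }) (vectorsOfSum-unique k zero)
vectorsOfSum-unique (suc k) (suc i) = AllPairs.++⁺
  (Unique.map⁺ (λ { refl → refl }) (vectorsOfSum-unique k (suc i)))
  (Unique.map⁺ (λ { {_ ∷ _} {_ ∷ _} refl → refl }) (vectorsOfSum-unique (suc k) i))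
  (All.map⁺ (All.universal (λ x → All.map⁺ (All.universal (λ { (_ ∷ _) () }) _)) _))

-- Listed in blocks of equal sum, so that a product over it can be collected into one power per
-- block.
vectorsBelow : ∀ k → ℕ → List (Vec ℕ k)
vectorsBelow k zero    = []
vectorsBelow k (suc m) = vectorsBelow k m ++ vectorsOfSum k m

vectorsBelow-sum : ∀ k m → All (λ x → Vec.sum x < m) (vectorsBelow k m)
vectorsBelow-sum k zero    = []
vectorsBelow-sum k (suc m) = All.++⁺ (All.map ℕ.m<n⇒m<1+n (vectorsBelow-sum k m))
  (All.map (λ { refl → ℕ.≤-refl }) (vectorsOfSum-sum k m))

vectorsBelow-complete : ∀ {k m} (x : Vec ℕ k) → Vec.sum x < m → x ∈ vectorsBelow k m
vectorsBelow-complete {k} {suc m} x (s≤s x≤m) with ℕ.m≤n⇒m<n∨m≡n x≤m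
... | inj₁ x<m = ∈-++⁺ˡ (vectorsBelow-complete x x<m)
... | inj₂ x≡m = ∈-++⁺ʳ (vectorsBelow k m) (vectorsOfSum-complete x x≡m)

vectorsBelow-unique : ∀ k m → Unique (vectorsBelow k m)
vectorsBelow-unique k zero    = []
vectorsBelow-unique k (suc m) = AllPairs.++⁺ (vectorsBelow-unique k m) (vectorsOfSum-unique k m)
  (All.map (λ x<m → All.map (λ y≡m x≡y → ℕ.<⇒≢ x<m (trans (cong Vec.sum x≡y) y≡m)) (vectorsOfSum-sum k m))
    (vectorsBelow-sum k m))

words : ∀ {A : Set} → List A → ∀ n → List (Vec A n)
words xs zero    = [] ∷ []
words xs (suc n) = cartesianProductWith _∷_ xs (words xs n)

words-complete : ∀ {A : Set} {xs : List A} {n} (v : Vec A n) → All (_∈ xs) (toList v) → v ∈ words xs n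
words-complete []      []           = here refl
words-complete (x ∷ v) (x∈xs ∷ v⊆xs) = ∈-cartesianProductWith⁺ _∷_ x∈xs (words-complete v v⊆xs)

words-unique : ∀ {A : Set} {xs : List A} n → Unique xs → Unique (words xs n)
words-unique zero    xs! = [] ∷ []
words-unique (suc n) xs! = Unique.cartesianProductWith⁺ _∷_ ∷-injective xs! (words-unique n xs!)

module _ (n k r : ℕ) where

  private
    homogeneous? : ∀ e → Dec (degree {n} {k} e ≡ r)
    homogeneous? e = degree e ℕ.≟ r

  -- A row sum is at most the degree, so rows of sum below `suc r` suffice and the list is finite
  -- before filtering.
  exponentMatrices : List (Vec (Vec ℕ k) n)
  exponentMatrices = filter homogeneous? (words (vectorsBelow k (suc r)) n)

  exponentMatrices-complete : ∀ e → degree e ≡ r → e ∈ exponentMatrices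
  exponentMatrices-complete e p = ∈-filter⁺ homogeneous?
    (words-complete e (All.map
      (λ le → vectorsBelow-complete _
        (s≤s (ℕ.≤-trans le (ℕ.≤-reflexive (trans (sym (degree-total e)) p)))))
      (total-≥ Vec.sum e)))
    p

  monomials : Fin (length exponentMatrices) ↔ Monomial n k r
  monomials = mk↔ₛ′ to from (λ m → monomial-≡ (sym (Any.lookup-index (exponents∈ m))))
    (λ l → AllPairs⇒lookup-injective sym
      (Unique.filter⁺ homogeneous? (words-unique n (vectorsBelow-unique k (suc r)))) _ _
      (sym (Any.lookup-index (exponents∈ (to l)))))
    where
    to : Fin (length exponentMatrices) → Monomial n k r
    to l = monomial (List.lookup exponentMatrices l) (All.lookup
      (All.all-filter homogeneous? (words (vectorsBelow k (suc r)) n)) (∈-lookup l))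

    exponents∈ : ∀ m → Monomial.exponents m ∈ exponentMatrices
    -- The degree proof is an irrelevant field; decidability of equality on naturals makes it usable
    -- again.
    exponents∈ (monomial e p) = exponentMatrices-complete e (recompute (homogeneous? e) p)

    from : Monomial n k r → Fin (length exponentMatrices)
    from m = Any.index (exponents∈ m)

-- Pairs of monomials as words in colours

zip-tabulate : ∀ {A B : Set} {n} (f : Fin n → A) (g : Fin n → B) →
  zip (tabulate f) (tabulate g) ≡ tabulate (λ i → f i , g i)
zip-tabulate {n = zero}  f g = refl
zip-tabulate {n = suc n} f g = cong (_ ∷_) (zip-tabulate (f ∘ suc) (g ∘ suc))

zip-permute : ∀ {A B : Set} {n} σ (v : Vec A n) (w : Vec B n) →
  zip (permute σ v) (permute σ w) ≡ permute σ (zip v w)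
zip-permute σ v w = trans (zip-tabulate _ _) (tabulate-cong λ i → sym (lookup-zip _ v w))

Colour : ℕ → Set
Colour k = Vec ℕ k × Vec ℕ k

colours : ∀ k → ℕ → List (Colour k)
colours k m = cartesianProduct (vectorsBelow k m) (vectorsBelow k m)

deg₁ deg₂ : ∀ {k} → Colour k → ℕ
deg₁ (x , y) = Vec.sum x
deg₂ (x , y) = Vec.sum y

module _ (n k r : ℕ) where

  Bihomogeneous : Vec (Colour k) n → Set
  Bihomogeneous v = total deg₁ v ≡ r × total deg₂ v ≡ r

  bihomogeneous? : ∀ v → Dec (Bihomogeneous v)
  bihomogeneous? v = (total deg₁ v ℕ.≟ r) ×-dec (total deg₂ v ℕ.≟ r)

module _ (n k r m : ℕ) where

  private
    Homogeneous : Vec (Colour k) n → Set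
    Homogeneous = Bihomogeneous n k r

    homogeneous? : ∀ v → Dec (Homogeneous v)
    homogeneous? = bihomogeneous? n k r

  orbits : List (Vec (Colour k) n)
  orbits = filter homogeneous? (multisets (colours k m) n)

  orbits-injective : ∀ i j → List.lookup orbits i ≋ List.lookup orbits j → i ≡ j
  orbits-injective = AllPairs⇒lookup-injective {R = _≋_} ↭-sym (AllPairs.filter⁺ homogeneous?
    (multisets-distinct n (Unique.cartesianProduct⁺ (vectorsBelow-unique k m) (vectorsBelow-unique k m))))

  -- Each letter has both degrees at most the totals, hence at most `r` and below the cut-off `m`.
  -- The listed word equivalent to `v` has the same totals, so it survives the filter.
  orbits-complete : r < m → ∀ v → Homogeneous v → Any (v ≋_) orbits
  orbits-complete r<m v (p , q) =
    let u , u∈ , v≋u = find (multisets-complete (≡-dec (Vec.≡-dec ℕ._≟_) (Vec.≡-dec ℕ._≟_)) v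
          (All.zipWith (λ (≤₁ , ≤₂) → ∈-cartesianProduct⁺ (below p ≤₁) (below q ≤₂))
            (total-≥ deg₁ v , total-≥ deg₂ v)))
    in lose (∈-filter⁺ homogeneous? u∈
         (trans (sym (total-≋ deg₁ v≋u)) p , trans (sym (total-≋ deg₂ v≋u)) q)) v≋u
    where
    below : ∀ {x : Vec ℕ k} {t} → t ≡ r → Vec.sum x ≤ t → x ∈ vectorsBelow k m
    below refl x≤r = vectorsBelow-complete _ (ℕ.≤-<-trans x≤r r<m)

  labelling : r < m → OrbitalLabelling n k r (length orbits)
  labelling r<m = record
    { label     = label
    ; invariant = λ σ x y → label-unique (σ • x) (σ • y) (label x y) (↭-trans
        (↭-reflexive (cong toList (zip-permute σ (exponents x) (exponents y))))
        (↭-trans (permute-≋ σ (pair x y)) (label-≋ x y)))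
    ; separates = separates
    -- Unzipping the listed word gives a representative pair, and zipping it again recovers the word
    -- exactly.
    ; repˡ      = λ o → monomial _ (degree-proj proj₁ o (proj₁ (orbit-homogeneous o)))
    ; repʳ      = λ o → monomial _ (degree-proj proj₂ o (proj₂ (orbit-homogeneous o)))
    ; label-rep = λ o → label-unique _ _ o
        (↭-reflexive (cong toList (zip-map-proj (List.lookup orbits o))))
    }
    where
    open Monomial

    pair : Monomial n k r → Monomial n k r → Vec (Colour k) n
    pair x y = zip (exponents x) (exponents y)

    degree-recompute : ∀ (x : Monomial n k r) → degree (exponents x) ≡ r
    degree-recompute (monomial e p) = recompute (degree e ℕ.≟ r) p

    pair-homogeneous : ∀ x y → Homogeneous (pair x y)
    pair-homogeneous x y =
      total-proj proj₁ x (map-proj₁-zip (exponents x) (exponents y)) ,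
      total-proj proj₂ y (map-proj₂-zip (exponents x) (exponents y))
      where
      total-proj : ∀ π z → Vec.map π (pair x y) ≡ exponents z → total (Vec.sum ∘ π) (pair x y) ≡ r
      total-proj π z eq = trans
        (cong Vec.sum (trans (map-∘ Vec.sum π (pair x y)) (cong (Vec.map Vec.sum) eq)))
        (trans (sym (degree-total (exponents z))) (degree-recompute z))

    pair∈ : ∀ x y → Any (pair x y ≋_) orbits
    pair∈ x y = orbits-complete r<m (pair x y) (pair-homogeneous x y)

    label : Monomial n k r → Monomial n k r → Fin (length orbits)
    label x y = Any.index (pair∈ x y)

    label-≋ : ∀ x y → pair x y ≋ List.lookup orbits (label x y)
    label-≋ x y = Any.lookup-index (pair∈ x y)

    label-unique : ∀ x y o → pair x y ≋ List.lookup orbits o → label x y ≡ o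
    label-unique x y o p = orbits-injective _ _ (↭-trans (↭-sym (label-≋ x y)) p)

    separates : ∀ {x y x′ y′} → label x y ≡ label x′ y′ → ∃[ σ ] x′ ≡ σ • x × y′ ≡ σ • y
    separates {x} {y} {x′} {y′} eq =
      -- One `σ` permutes the whole zipped word, so the two projections give both equations with the
      -- same permutation.
      let σ , p = ≋⇒permute (↭-trans (label-≋ x y) (↭-sym
                    (subst (λ o → pair x′ y′ ≋ List.lookup orbits o) (sym eq) (label-≋ x′ y′))))
          q = trans p (sym (zip-permute σ (exponents x) (exponents y)))
      in σ
       , monomial-≡ (trans (sym (map-proj₁-zip _ _)) (trans (cong (Vec.map proj₁) q) (map-proj₁-zip _ _)))
       , monomial-≡ (trans (sym (map-proj₂-zip _ _)) (trans (cong (Vec.map proj₂) q) (map-proj₂-zip _ _)))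

    orbit-homogeneous : ∀ o → Homogeneous (List.lookup orbits o)
    orbit-homogeneous o = All.lookup
      (All.all-filter homogeneous? (multisets (colours k m) n)) (∈-lookup o)

    degree-proj : ∀ (π : Colour k → Vec ℕ k) o → total (Vec.sum ∘ π) (List.lookup orbits o) ≡ r →
      degree (Vec.map π (List.lookup orbits o)) ≡ r
    degree-proj π o p = trans (degree-total (Vec.map π v))
      (trans (cong Vec.sum (sym (map-∘ Vec.sum π v))) p)
      where
      v = List.lookup orbits o

    zip-map-proj : ∀ (v : Vec (Colour k) n) → zip (Vec.map proj₁ v) (Vec.map proj₂ v) ≡ v
    zip-map-proj v = trans (sym (map-<,>-zip proj₁ proj₂ v)) (map-id v)

-- Power series

module SumsAndProducts (R : CommutativeRing 0ℓ 0ℓ) where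

  open CommutativeRing R hiding (refl; sym; trans)
  private module R = CommutativeRing R
  open CommutativeSemiringExp commutativeSemiring using (_^_)

  module _ {A : Set} (f : A → Carrier) where

    sumOver productOver : List A → Carrier
    sumOver     = List.foldr (λ x s → f x + s) 0#
    productOver = List.foldr (λ x p → f x * p) 1#

    weight : ∀ {n} → Vec A n → Carrier
    weight = Vec.foldr _ (λ x p → f x * p) 1#

    sumOver-++ : ∀ xs ys → sumOver (xs ++ ys) ≈ sumOver xs + sumOver ys
    sumOver-++ []       ys = R.sym (+-identityˡ _)
    sumOver-++ (x ∷ xs) ys = R.trans (+-congˡ (sumOver-++ xs ys)) (R.sym (+-assoc _ _ _))

    productOver-++ : ∀ xs ys → productOver (xs ++ ys) ≈ productOver xs * productOver ys
    productOver-++ []       ys = R.sym (*-identityˡ _)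
    productOver-++ (x ∷ xs) ys = R.trans (*-congˡ (productOver-++ xs ys)) (R.sym (*-assoc _ _ _))

    productOver-const : ∀ c {xs} → All (λ x → f x ≈ c) xs → productOver xs ≈ c ^ length xs
    productOver-const c []         = R.refl
    productOver-const c (eq ∷ eqs) = *-cong eq (productOver-const c eqs)

  sumOver-cong : ∀ {A : Set} {f g : A → Carrier} → (∀ x → f x ≈ g x) → ∀ xs →
    sumOver f xs ≈ sumOver g xs
  sumOver-cong f≈g []       = R.refl
  sumOver-cong f≈g (x ∷ xs) = +-cong (f≈g x) (sumOver-cong f≈g xs)

  productOver-cong : ∀ {A : Set} {f g : A → Carrier} → (∀ x → f x ≈ g x) → ∀ xs →
    productOver f xs ≈ productOver g xs
  productOver-cong f≈g []       = R.refl
  productOver-cong f≈g (x ∷ xs) = *-cong (f≈g x) (productOver-cong f≈g xs)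

  sumOver-weight-∷ : ∀ {A : Set} {n} (f : A → Carrier) x (vs : List (Vec A n)) →
    sumOver (weight f) (List.map (x ∷_) vs) ≈ f x * sumOver (weight f) vs
  sumOver-weight-∷ f x []       = R.sym (zeroʳ _)
  sumOver-weight-∷ f x (v ∷ vs) = R.trans (+-congˡ (sumOver-weight-∷ f x vs)) (R.sym (distribˡ _ _ _))

  productOver-map : ∀ {A B : Set} (f : B → Carrier) (g : A → B) xs →
    productOver f (List.map g xs) ≡ productOver (λ x → f (g x)) xs
  productOver-map f g []       = refl
  productOver-map f g (x ∷ xs) = cong (f (g x) *_) (productOver-map f g xs)

  productOver-cartesianProduct : ∀ {A B : Set} (f : A × B → Carrier) xs ys →
    productOver f (cartesianProduct xs ys) ≈ productOver (λ x → productOver (λ y → f (x , y)) ys) xs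
  productOver-cartesianProduct f []       ys = R.refl
  productOver-cartesianProduct f (x ∷ xs) ys = R.trans
    (productOver-++ f (List.map (x ,_) ys) (cartesianProduct xs ys))
    (*-cong (R.reflexive (productOver-map f (x ,_) ys)) (productOver-cartesianProduct f xs ys))

module Coefficients (R : CommutativeRing 0ℓ 0ℓ) where

  private module R = CommutativeRing R
  open R using (Carrier; _≈_; _+_; _*_; 0#; 1#)
  open PowerSeries R
  private module S = CommutativeRing ring
  open CommutativeSemiringExp S.commutativeSemiring using () renaming (_^_ to _^ˢ_)
  open SumsAndProducts using (productOver)
  open SumsAndProducts R hiding (productOver)
  open SetoidReasoning R.setoid

  ⊛-scaleˡ : ∀ c f g n → ((λ m → c * f m) ⊛ g) n ≈ c * (f ⊛ g) n
  ⊛-scaleˡ c f g zero    = R.*-assoc _ _ _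
  ⊛-scaleˡ c f g (suc n) = R.trans
    (R.+-cong (R.*-assoc _ _ _) (⊛-scaleˡ c (λ m → f (suc m)) g n)) (R.sym (R.distribˡ _ _ _))

  -- The tail of the geometric series G is c times G, so G = 1 + cXG; this is that identity
  -- multiplied by `g`.
  1/1-X-⊛-suc : ∀ c g n → (1/1- c X ⊛ g) (suc n) ≈ g (suc n) + c * (1/1- c X ⊛ g) n
  1/1-X-⊛-suc c g n = R.+-cong (R.*-identityˡ _) (⊛-scaleˡ c 1/1- c X g n)

  -- The coefficients of ∏ 1/(1 − cₐ X) are the complete homogeneous symmetric polynomials in the cₐ.
  productOver-1/1-X : ∀ {A : Set} (c : A → Carrier) xs n →
    productOver ring (λ a → 1/1- c a X) xs n ≈ sumOver (weight c) (multisets xs n)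
  productOver-1/1-X c []       zero    = R.sym (R.+-identityʳ _)
  productOver-1/1-X c []       (suc n) = R.refl
  productOver-1/1-X c (x ∷ xs) zero    = R.trans (R.*-identityˡ _) (productOver-1/1-X c xs zero)
  productOver-1/1-X c (x ∷ xs) (suc n) = begin
    (1/1- c x X ⊛ P) (suc n)
      ≈⟨ 1/1-X-⊛-suc (c x) P n ⟩
    P (suc n) + c x * (1/1- c x X ⊛ P) n
      ≈⟨ R.+-cong (productOver-1/1-X c xs (suc n)) (R.*-congˡ (productOver-1/1-X c (x ∷ xs) n)) ⟩
    sumOver (weight c) (multisets xs (suc n)) + c x * sumOver (weight c) (multisets (x ∷ xs) n)
      ≈⟨ R.+-congˡ (sumOver-weight-∷ c x (multisets (x ∷ xs) n)) ⟨
    sumOver (weight c) (multisets xs (suc n)) + sumOver (weight c) (List.map (x ∷_) (multisets (x ∷ xs) n))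
      ≈⟨ sumOver-++ (weight c) (multisets xs (suc n)) _ ⟨
    sumOver (weight c) (multisets (x ∷ xs) (suc n)) ∎
    where
    P = productOver ring (λ a → 1/1- c a X) xs

  X-⊛-suc : ∀ f n → (X ⊛ f) (suc n) ≈ f n
  X-⊛-suc f n = R.trans (R.+-cong (R.zeroˡ _) (at (S.*-identityˡ f) n)) (R.+-identityˡ _)

  X^-constant : ∀ i c a → (X ^ˢ i S.* constant c) a ≈ (if does (i ℕ.≟ a) then c else 0#)
  X^-constant zero    c zero    = at (S.*-identityˡ (constant c)) zero
  X^-constant zero    c (suc a) = at (S.*-identityˡ (constant c)) (suc a)
  X^-constant (suc i) c zero    = R.trans (R.*-congʳ (R.zeroˡ _)) (R.zeroˡ _)
  X^-constant (suc i) c (suc a) = begin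
    ((X S.* X ^ˢ i) S.* constant c) (suc a)  ≈⟨ at (S.*-assoc X (X ^ˢ i) (constant c)) (suc a) ⟩
    (X S.* (X ^ˢ i S.* constant c)) (suc a)  ≈⟨ X-⊛-suc (X ^ˢ i S.* constant c) a ⟩
    (X ^ˢ i S.* constant c) a                ≈⟨ X^-constant i c a ⟩
    (if does (i ℕ.≟ a) then c else 0#)       ∎

  constant-* : ∀ c d → constant (c * d) S.≈ constant c S.* constant d
  constant-* c d = mk≋ go
    where
    0-⊛ : ∀ g n → ((λ _ → 0#) ⊛ g) n ≈ 0#
    0-⊛ g zero    = R.zeroˡ _
    0-⊛ g (suc n) = R.trans (R.+-cong (R.zeroˡ _) (0-⊛ g n)) (R.+-identityˡ _)

    go : ∀ n → constant (c * d) n ≈ (constant c ⊛ constant d) n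
    go zero    = R.refl
    go (suc n) = R.sym (R.trans (R.+-cong (R.zeroʳ c) (0-⊛ (constant d) n)) (R.+-identityˡ _))

  constant-cong : ∀ {c d} → c ≈ d → constant c S.≈ constant d
  constant-cong c≈d = mk≋ λ { zero → c≈d ; (suc n) → R.refl }

-- The coefficient of the product over colours as a number of orbits

open Rings
open SumsAndProducts using (sumOver; productOver; weight; sumOver-cong;
  productOver-++; productOver-const; productOver-cong; productOver-cartesianProduct)

qᵃtᵇ-+ : ∀ i i′ j j′ → qᵃtᵇ (i ℕ.+ i′) (j ℕ.+ j′) ℤ⟦t,q⟧.≈ qᵃtᵇ i j ℤ⟦t,q⟧.* qᵃtᵇ i′ j′
qᵃtᵇ-+ i i′ j j′ = ℤ⟦t,q⟧.trans
  (ℤ⟦t,q⟧.*-cong (SemiringExp.^-homo-* ℤ⟦t,q⟧.semiring Q.X i i′)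
    (ℤ⟦t,q⟧.trans (constant-cong (SemiringExp.^-homo-* ℤ⟦t⟧.semiring T.X j j′))
      (constant-* (T.X ℤ⟦t⟧.^ j) (T.X ℤ⟦t⟧.^ j′))))
  (interchange (Q.X ℤ⟦t,q⟧.^ i) (Q.X ℤ⟦t,q⟧.^ i′) _ _)
  where
  open Coefficients T.ring using (constant-*; constant-cong)
  open CommutativeSemigroupProperties ℤ⟦t,q⟧.*-commutativeSemigroup using (interchange)

qᵃtᵇ-coefficient : ∀ i j a b → qᵃtᵇ i j a b ≡ (if does (i ℕ.≟ a) ∧ does (j ℕ.≟ b) then ℤ.1ℤ else ℤ.0ℤ)
qᵃtᵇ-coefficient i j a b = trans
  (T.at (Coefficients.X^-constant T.ring i (T.X ℤ⟦t⟧.^ j) a) b)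
  (go (does (i ℕ.≟ a)))
  where
  go : ∀ c → (if c then T.X ℤ⟦t⟧.^ j else ℤ⟦t⟧.0#) b ≡ (if c ∧ does (j ℕ.≟ b) then ℤ.1ℤ else ℤ.0ℤ)
  go false = refl
  -- `X^-constant` expects a constant factor on the right; the unit series supplies it.
  go true  = trans (sym (T.at (ℤ⟦t⟧.*-identityʳ (T.X ℤ⟦t⟧.^ j)) b))
    (Coefficients.X^-constant ℤ.+-*-commutativeRing j ℤ.1ℤ b)

length-filter-∷ : ∀ {A : Set} {P : Pred A 0ℓ} (P? : Decidable P) x xs →
  length (filter P? (x ∷ xs)) ≡ (if does (P? x) then 1 else 0) ℕ.+ length (filter P? xs)
length-filter-∷ P? x xs with does (P? x)
... | true  = refl
... | false = refl

colourMonomial : ∀ {k} → Colour k → Q.Series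
colourMonomial c = qᵃtᵇ (deg₁ c) (deg₂ c)

weight-colourMonomial : ∀ {k n} (v : Vec (Colour k) n) →
  weight Q.ring colourMonomial v ℤ⟦t,q⟧.≈ qᵃtᵇ (total deg₁ v) (total deg₂ v)
weight-colourMonomial []      = ℤ⟦t,q⟧.sym (ℤ⟦t,q⟧.*-identityˡ _)
weight-colourMonomial (c ∷ v) = ℤ⟦t,q⟧.trans
  (ℤ⟦t,q⟧.*-congˡ {colourMonomial c} (weight-colourMonomial v))
  (ℤ⟦t,q⟧.sym (qᵃtᵇ-+ (deg₁ c) (total deg₁ v) (deg₂ c) (total deg₂ v)))

module _ (n k r m : ℕ) where

  -- Each word contributes a single monomial in q and t, so extracting the coefficient of bidegree
  -- (r, r) counts the words that pass the filter. The two tests agree because `does` of a product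
  -- of decisions computes to a conjunction.
  sum-coefficient : ∀ vs → sumOver Q.ring (λ v → qᵃtᵇ (total deg₁ v) (total deg₂ v)) vs r r
    ≡ + length (filter (bihomogeneous? n k r) vs)
  sum-coefficient []       = refl
  sum-coefficient (v ∷ vs) = begin
    qᵃtᵇ (total deg₁ v) (total deg₂ v) r r
      ℤ.+ sumOver Q.ring (λ w → qᵃtᵇ (total deg₁ w) (total deg₂ w)) vs r r
      ≡⟨ cong₂ ℤ._+_ (qᵃtᵇ-coefficient (total deg₁ v) (total deg₂ v) r r) (sum-coefficient vs) ⟩
    (if does (P? v) then ℤ.1ℤ else ℤ.0ℤ) ℤ.+ + length (filter P? vs)
      ≡⟨ cong (ℤ._+ + length (filter P? vs)) (if-float +_ (does (P? v))) ⟨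
    + ((if does (P? v) then 1 else 0) ℕ.+ length (filter P? vs))
      ≡⟨ cong +_ (length-filter-∷ P? v vs) ⟨
    + length (filter P? (v ∷ vs)) ∎
    where
    open ≡-Reasoning
    P? = bihomogeneous? n k r

  product-coefficient :
    productOver Z.ring (λ c → Z.1/1- colourMonomial c X) (colours k m) n r r
      ≡ + length (orbits n k r m)
  product-coefficient = trans
    (T.at (Q.at (ℤ⟦t,q⟧.trans
      (Coefficients.productOver-1/1-X Q.ring colourMonomial (colours k m) n)
      (sumOver-cong Q.ring weight-colourMonomial (multisets (colours k m) n))) r) r)
    (sum-coefficient (multisets (colours k m) n))

-- Collecting the product over colours by bidegree

open ℤ⟦t,q,z⟧ using () renaming (_≈_ to _≈ᶻ_; _^_ to _^ᶻ_)
private module W = ℤ⟦t,q,z⟧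

∏<-cong : ∀ m {F G} → (∀ i → F i ≈ᶻ G i) → ∏< m F ≈ᶻ ∏< m G
∏<-cong zero    F≈G = W.refl
∏<-cong (suc m) F≈G = W.*-cong (∏<-cong m F≈G) (F≈G m)

∏<-^ : ∀ m F e → ∏< m F ^ᶻ e ≈ᶻ ∏< m (λ i → F i ^ᶻ e)
∏<-^ zero    F zero    = W.refl
∏<-^ zero    F (suc e) = W.trans (W.*-identityˡ _) (∏<-^ zero F e)
∏<-^ (suc m) F e       = W.trans (W.^-distrib-* (∏< m F) (F m) e) (W.*-congʳ (∏<-^ m F e))

-- The factor depends on a vector only through its sum, so each block of equal sum contributes a
-- power.
productOver-vectorsBelow : ∀ k (G : ℕ → Z.Series) m →
  productOver Z.ring (λ x → G (Vec.sum x)) (vectorsBelow k m)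
    ≈ᶻ ∏< m (λ i → G i ^ᶻ length (vectorsOfSum k i))
productOver-vectorsBelow k G zero    = W.refl
productOver-vectorsBelow k G (suc m) = W.trans
  (productOver-++ Z.ring (λ x → G (Vec.sum x)) (vectorsBelow k m) (vectorsOfSum k m))
  (W.*-cong (productOver-vectorsBelow k G m)
    (productOver-const Z.ring (λ x → G (Vec.sum x)) (G m)
      (All.map (λ { refl → W.refl }) (vectorsOfSum-sum k m))))

-- A colour is a pair, so collecting by sum is done once per coordinate. The power from the first
-- coordinate is then moved inside the product over the second, where the two exponents multiply to
-- `exponent k i j`.
productOver-colours : ∀ k m →
  productOver Z.ring (λ c → Z.1/1- colourMonomial c X) (colours k m) ≈ᶻ ∏< m (λ i → ∏< m (factor k i))
productOver-colours k m = begin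
  productOver Z.ring (λ c → Z.1/1- colourMonomial c X) (colours k m)
    ≈⟨ productOver-cartesianProduct Z.ring (λ c → Z.1/1- colourMonomial c X)
         (vectorsBelow k m) (vectorsBelow k m) ⟩
  productOver Z.ring (λ x →
    productOver Z.ring (λ y → P (Vec.sum x) (Vec.sum y)) (vectorsBelow k m)) (vectorsBelow k m)
    ≈⟨ productOver-cong Z.ring (λ x → productOver-vectorsBelow k (P (Vec.sum x)) m) (vectorsBelow k m) ⟩
  productOver Z.ring (λ x → ∏< m (λ j → P (Vec.sum x) j ^ᶻ ℓ j)) (vectorsBelow k m)
    ≈⟨ productOver-vectorsBelow k (λ i → ∏< m (λ j → P i j ^ᶻ ℓ j)) m ⟩
  ∏< m (λ i → ∏< m (λ j → P i j ^ᶻ ℓ j) ^ᶻ ℓ i)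
    ≈⟨ ∏<-cong m (λ i → W.trans (∏<-^ m (λ j → P i j ^ᶻ ℓ j) (ℓ i)) (∏<-cong m (λ j → exponents i j))) ⟩
  ∏< m (λ i → ∏< m (factor k i)) ∎
  where
  open SetoidReasoning W.setoid
  P : ℕ → ℕ → Z.Series
  P i j = Z.1/1- (qᵃtᵇ i j) X
  ℓ : ℕ → ℕ
  ℓ i = length (vectorsOfSum k i)
  exponents : ∀ i j → (P i j ^ᶻ ℓ j) ^ᶻ ℓ i ≈ᶻ factor k i j
  exponents i j = W.trans (SemiringExp.^-assocʳ W.semiring (P i j) (ℓ j) (ℓ i))
    (SemiringExp.^-congʳ W.semiring (P i j)
      (trans (ℕ.*-comm (ℓ j) (ℓ i)) (cong₂ ℕ._*_ (length-vectorsOfSum k i) (length-vectorsOfSum k j))))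

-- Truncation of the infinite products

open Truncation

-- Factors with `j` > `r` are 1 modulo t^(r+1), so all partial products of length above `r` agree
-- there. A congruence is needed, and not just one coefficient, because multiplying the rows mixes
-- their coefficients.
row-truncation : ∀ k {m r} → r < m → ∀ i →
  Congruence._≅_ (mod-t (suc r)) (row k i) (∏< m (factor k i))
row-truncation k {m} {r} r<m i n a b b<1+r = begin
  -- The opaque cut-off `N` may be at most `r`; convergence first allows it to be enlarged to
  -- `N ⊔ m`.
  ∏< N (factor k i) n a b        ≡⟨ proj₂ (inner-multipliable k i n a b) (N ⊔ m) (ℕ.m≤m⊔n N m) ⟨
  ∏< (N ⊔ m) (factor k i) n a b  ≡⟨ stable (ℕ.≤-trans r<m (ℕ.m≤n⊔m N m)) ⟩
  ∏< (suc r) (factor k i) n a b  ≡⟨ stable r<m ⟨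
  ∏< m (factor k i) n a b        ∎
  where
  open ≡-Reasoning
  N = proj₁ (inner-multipliable k i n a b)
  stable : ∀ {l} → suc r ≤ l → ∏< l (factor k i) n a b ≡ ∏< (suc r) (factor k i) n a b
  stable r<l = Stabilise.stable (mod-t (suc r)) (factor k i) (suc r)
    (λ j r<j → factor≅1 (mod-t′ (suc r)) k i j (t-small i r<j)) (ℕ.≤⇒≤′ r<l) n a b b<1+r

∏<-≅ : ∀ (E : Congruence Z.ring) m {F G} → (∀ i → Congruence._≅_ E (F i) (G i)) →
  Congruence._≅_ E (∏< m F) (∏< m G)
∏<-≅ E zero    F≅G = Congruence.≅-refl E
∏<-≅ E (suc m) F≅G = Congruence.*-≅ E (∏<-≅ E m F≅G) (F≅G m)

-- The cut-offs chosen in inner-multipliable and outer-multipliable are abstract, and the inner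
-- ones vary with i; modulo t^(r+1) all of them may be replaced by one large enough m.
generatingFunction-truncation : ∀ k n r → ∃[ m ] r < m ×
  generatingFunction k n r r ≡ ∏< m (λ i → ∏< m (factor k i)) n r r
generatingFunction-truncation k n r = m , r<m , trans
  (sym (proj₂ (outer-multipliable k n r r) m (ℕ.m≤m⊔n N (suc r))))
  (∏<-≅ (mod-t (suc r)) m (row-truncation k r<m) n r r ℕ.≤-refl)
  where
  N = proj₁ (outer-multipliable k n r r)
  m = N ⊔ suc r
  r<m : r < m
  r<m = ℕ.m≤n⊔m N (suc r)

corollary5p4 : (n k r : ℕ) → .{{_ : NonZero n}} → .{{_ : NonZero k}} → .{{_ : NonZero r}} →
    ∃[ d ] (HasDimension ℂ-ring (𝒜 r k n) d × + d ≡ generatingFunction k n r r)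
corollary5p4 n k r = let m , r<m , truncation = generatingFunction-truncation k n r in
  -- The orbits are listed with the same cut-off as the truncated product, so basis and coefficient
  -- refer to one list.
  length (orbits n k r m) ,
  EquivariantBasis.hasDimension ℂ-ring (monomials n k r) (labelling n k r m r<m) ,
  (begin
    + length (orbits n k r m)
      ≡⟨ product-coefficient n k r m ⟨
    productOver Z.ring (λ c → Z.1/1- colourMonomial c X) (colours k m) n r r
      ≡⟨ T.at (Q.at (Z.at (productOver-colours k m) n) r) r ⟩
    ∏< m (λ i → ∏< m (factor k i)) n r r
      ≡⟨ truncation ⟨
    generatingFunction k n r r ∎)
  where open ≡-Reasoning
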